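{- Let $\ell>2$. Every $(\ell,0)$-JM partition is a node of the ladder crystal $ladd_\ell$, i.e. can be obtained from the empty partition by applying a finite sequence of ladder crystal operators $\widehat f_i$.
   Context: Partitions are identified with Young diagrams; $(x,y)$ is the box in row $x$, column $y$, with residue $y-x\bmod\ell$. The hook length $h^\lambda_{(a,c)}$ of a box is the number of boxes of $\lambda$ to its right in its row or below it in its column, including itself. $\lambda$ is an $(\ell,0)$-JM partition if there do NOT exist boxes $(a,b),(a,y),(x,b)$ in $\lambda$ with $\ell\mid h^\lambda_{(a,b)}$, $\ell\nmid h^\lambda_{(a,y)}$, $\ell\nmid h^\lambda_{(x,b)}$. Ladder crystal operators: for residue $i$, mark removable boxes of residue $i$ by $-$ and addable positions of residue $i$ by $+$; read them ordering positions $(x,y)$ by ladder number $x+(\ell-1)(y-1)$ increasing and, within a ladder, top to bottom; successively cancel adjacent pairs $-+$. Then $\widehat e_i\lambda$ removes the box of the leftmost remaining $-$ and $\widehat f_i\lambda$ adds the box of the rightmost remaining $+$ (each $0$ if no such sign). The ladder crystal $ladd_\ell$ has as nodes the partitions obtained from the empty partition by finite sequences of the operators $\widehat f_i$, $0\le i<\ell$. -}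

module Defs where

open import Data.Nat using (ℕ; zero; suc; _+_; _*_; _∸_; _≤_; _<_; _<ᵇ_; _≡ᵇ_)
open import Data.Nat.Divisibility using (_∣_)
open import Data.Bool using (Bool; true; false; if_then_else_; _∧_; _∨_)
open import Data.List using (List; []; _∷_; length; foldl; upTo; map; concatMap)
open import Data.List.Relation.Unary.All using (All)
open import Data.List.Relation.Unary.Linked using (Linked)
open import Data.Maybe using (Maybe; just; nothing)
open import Data.Product using (_×_; _,_; ∃; ∃-syntax)
open import Data.Integer using (ℤ; +_; _-_)
open import Data.Integer.DivMod using (_%ℕ_)
open import Relation.Nullary using (¬_)
open import Relation.Binary.PropositionalEquality using (_≡_)

-- Partitions: finite lists of positive, weakly decreasing parts.
-- Rows and columns are 1-indexed; (x , y) is the box in row x, column y.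

IsPartition : List ℕ → Set
IsPartition λ′ = All (1 ≤_) λ′ × Linked (λ a b → b ≤ a) λ′

-- length of row x (1-indexed); 0 for x = 0 or x beyond the last row
row : List ℕ → ℕ → ℕ
row _        zero          = 0
row []       (suc _)       = 0
row (p ∷ _)  (suc zero)    = p
row (_ ∷ ps) (suc (suc x)) = row ps (suc x)

col : List ℕ → ℕ → ℕ
col []       c = 0
col (p ∷ ps) c = if c <ᵇ suc p then suc (col ps c) else col ps c

InDiagram : List ℕ → ℕ → ℕ → Set
InDiagram λ′ x y = 1 ≤ x × 1 ≤ y × y ≤ row λ′ x

hook : List ℕ → ℕ → ℕ → ℕ
hook λ′ a c = (row λ′ a ∸ c) + (col λ′ c ∸ a) + 1

IsJM : ℕ → List ℕ → Set
IsJM ℓ λ′ = ¬ (∃[ a ] ∃[ b ] ∃[ x ] ∃[ y ]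
                 (InDiagram λ′ a b × InDiagram λ′ a y × InDiagram λ′ x b
                  × ℓ ∣ hook λ′ a b × ¬ (ℓ ∣ hook λ′ a y) × ¬ (ℓ ∣ hook λ′ x b)))

-- Residues: res(x , y) = (y - x) mod ℓ  (ℓ = 0 never used; ℓ > 2 below)

residue : ℕ → ℕ → ℕ → ℕ
residue zero      x y = 0
residue (suc k)   x y = ((+ y) - (+ x)) %ℕ suc k

ladder : ℕ → ℕ → ℕ → ℕ
ladder ℓ x y = x + (ℓ ∸ 1) * (y ∸ 1)

data Sign : Set where
  minus plus : Sign

record Node : Set where
  constructor node
  field
    rx  : ℕ
    ry  : ℕ
    sgn : Sign

removableAt : List ℕ → ℕ → List Node
removableAt λ′ x =
  if (row λ′ (suc x) <ᵇ row λ′ x) then node x (row λ′ x) minus ∷ [] else []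

addableAt : List ℕ → ℕ → List Node
addableAt λ′ x =
  if (x ≡ᵇ 1) ∨ (row λ′ x <ᵇ row λ′ (x ∸ 1))
  then node x (suc (row λ′ x)) plus ∷ [] else []

allNodes : List ℕ → List Node
allNodes λ′ =
  concatMap (λ k → removableAt λ′ (suc k) Data.List.++ addableAt λ′ (suc k))
            (upTo (suc (length λ′)))

filterRes : ℕ → ℕ → List Node → List Node
filterRes ℓ i []       = []
filterRes ℓ i (n ∷ ns) =
  if residue ℓ (Node.rx n) (Node.ry n) ≡ᵇ i
  then n ∷ filterRes ℓ i ns else filterRes ℓ i ns

before : ℕ → Node → Node → Bool
before ℓ (node x y _) (node x′ y′ _) =
  (ladder ℓ x y <ᵇ ladder ℓ x′ y′)
  ∨ ((ladder ℓ x y ≡ᵇ ladder ℓ x′ y′) ∧ (x <ᵇ x′))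

insertN : ℕ → Node → List Node → List Node
insertN ℓ n []       = n ∷ []
insertN ℓ n (m ∷ ms) = if before ℓ n m then n ∷ m ∷ ms else m ∷ insertN ℓ n ms

sortN : ℕ → List Node → List Node
sortN ℓ []       = []
sortN ℓ (n ∷ ns) = insertN ℓ n (sortN ℓ ns)

signature : ℕ → ℕ → List ℕ → List Node
signature ℓ i λ′ = sortN ℓ (filterRes ℓ i (allNodes λ′))

-- cancel adjacent pairs (- +) successively; the result is kept as a
-- stack, i.e. the reduced word in reverse order
step : List Node → Node → List Node
step (node x y minus ∷ st) (node x′ y′ plus) = st
step st                    n                 = n ∷ st

reducedRev : List Node → List Node
reducedRev = foldl step []

-- first plus in the reversed reduced word = rightmost remaining plus
firstPlus : List Node → Maybe Node
firstPlus []                    = nothing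
firstPlus (node x y plus ∷ _)   = just (node x y plus)
firstPlus (node _ _ minus ∷ ns) = firstPlus ns

-- add a box at the end of row x (1-indexed; x = length + 1 starts a new row)
addBox : List ℕ → ℕ → List ℕ
addBox ps       zero          = ps
addBox []       (suc _)       = 1 ∷ []
addBox (p ∷ ps) (suc zero)    = suc p ∷ ps
addBox (p ∷ ps) (suc (suc x)) = p ∷ addBox ps (suc x)

-- ladder crystal operator f̂_i ; nothing stands for 0
fhat : ℕ → ℕ → List ℕ → Maybe (List ℕ)
fhat ℓ i λ′ with firstPlus (reducedRev (signature ℓ i λ′))
... | nothing          = nothing
... | just (node x _ _) = just (addBox λ′ x)

data InLadd (ℓ : ℕ) : List ℕ → Set where
  empty : InLadd ℓ []
  apply : ∀ {λ′ μ} (i : ℕ) → i < ℓ → InLadd ℓ λ′ → fhat ℓ i λ′ ≡ just μ → InLadd ℓ μ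

{-# OPTIONS --safe #-}
module Submission where

-- Encode a partition by its beads row(a) - a + N: the hook of (a , c) is the distance from the
-- gap of column c up to the bead of row a, so the JM condition says that for a bead b and a gap
-- v < b on the same runner, either all gaps below b or all beads above v lie on that runner.
-- Two consequences drive the induction.
--  * For every residue i the addable i-boxes of a JM partition all precede its removable i-boxes
--    in the ladder order: the obstructing beads or gaps lie on one runner and are thus spaced
--    at least ℓ apart. So nothing cancels in the i-signature, and this remains so while the
--    removable i-boxes are taken off one at a time, each the first in the ladder order; every
--    such removal is undone by f̂ᵢ.
--  * Removing all removable i-boxes, which on words slides beads from runner i down to runner
--    i - 1, preserves the JM condition.

open import Defs
open import Data.Bool using (Bool; true; false; if_then_else_; _∧_; _∨_)
open import Data.Bool.Properties using (∧-conicalˡ; ∧-conicalʳ; ∨-conicalˡ; ∨-conicalʳ; ⇔→≡)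
open import Data.Empty using (⊥; ⊥-elim)
import Data.Integer as ℤ
import Data.Integer.DivMod as ℤᵈ
import Data.Integer.Properties as ℤₚ
open import Data.List using (List; []; _∷_; length; foldl; upTo; _++_)
open import Data.List.Membership.Propositional using (_∈_; lose)
open import Data.List.Membership.Propositional.Properties using (∈-concatMap⁺; ∈-++⁺ʳ; ∈-upTo⁺)
open import Data.List.Relation.Unary.All as All using (All; []; _∷_)
import Data.List.Relation.Unary.All.Properties as All
open import Data.List.Relation.Unary.Any using (here; there)
open import Data.List.Relation.Unary.Linked using (Linked; []; [-]; _∷_; tail)
open import Data.Maybe using (just)
open import Data.Nat
open import Data.Nat.DivMod
open import Data.Nat.Divisibility using (_∣_; divides; ∣⇒≤; m∣m*n)
open import Data.Nat.ListAction using (sum)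
open import Data.Nat.Properties
open import Data.Nat.Tactic.RingSolver using (solve-∀)
open import Data.Product using (_×_; _,_; ∃-syntax; proj₁; proj₂)
open import Data.Sum using (_⊎_; inj₁; inj₂; [_,_]′)
open import Function using (_∘_; flip; mk⇔)
open import Relation.Binary.Definitions using (tri<; tri≈; tri>)
open import Relation.Binary.PropositionalEquality
open import Relation.Nullary using (¬_; Dec; yes; no; does; contradiction)
open import Relation.Nullary.Decidable using (dec-true; dec-false; decidable-stable; _×-dec_)

-- Words on runners

module Runners (ℓ : ℕ) .{{_ : NonZero ℓ}} where

  infix 4 _~_

  _~_ : ℕ → ℕ → Set
  s ~ t = s % ℓ ≡ t % ℓ

  ~-+ : ∀ {s t} c → s ~ t → s + c ~ t + c
  ~-+ {s} {t} c eq =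
    trans (%-distribˡ-+ s c ℓ) (trans (cong (λ r → (r + c % ℓ) % ℓ) eq) (sym (%-distribˡ-+ t c ℓ)))

  ~-suc : ∀ {s t} → s ~ t → suc s ~ suc t
  ~-suc {s} {t} eq = subst₂ _~_ (+-comm s 1) (+-comm t 1) (~-+ 1 eq)

  -- Adding `ℓ - 1` more completes a full turn, which undoes the successor.
  ~-suc⁻¹ : ∀ {s t} → suc s ~ suc t → s ~ t
  ~-suc⁻¹ {s} {t} eq =
    trans (sym (wrap s)) (trans (~-+ (ℓ ∸ 1) eq) (wrap t))
    where
    wrap : ∀ u → suc u + (ℓ ∸ 1) ~ u
    wrap u = trans (cong (_% ℓ) (trans (sym (+-suc u (ℓ ∸ 1))) (cong (u +_) (m+[n∸m]≡n (>-nonZero⁻¹ ℓ)))))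
                   ([m+n]%n≡m%n u ℓ)

  ~⇒∣∸ : ∀ {s t} → s ~ t → ℓ ∣ s ∸ t
  ~⇒∣∸ {s} {t} eq = divides (s / ℓ ∸ t / ℓ) (begin
    s ∸ t                                          ≡⟨ cong₂ _∸_ (m≡m%n+[m/n]*n s ℓ) (m≡m%n+[m/n]*n t ℓ) ⟩
    (s % ℓ + s / ℓ * ℓ) ∸ (t % ℓ + t / ℓ * ℓ)      ≡⟨ cong (λ r → (r + s / ℓ * ℓ) ∸ (t % ℓ + t / ℓ * ℓ)) eq ⟩
    (t % ℓ + s / ℓ * ℓ) ∸ (t % ℓ + t / ℓ * ℓ)      ≡⟨ [m+n]∸[m+o]≡n∸o (t % ℓ) _ _ ⟩
    s / ℓ * ℓ ∸ t / ℓ * ℓ                          ≡⟨ sym (*-distribʳ-∸ ℓ (s / ℓ) (t / ℓ)) ⟩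
    (s / ℓ ∸ t / ℓ) * ℓ                            ∎)
    where open ≡-Reasoning

  ∣⇒~ : ∀ {s t d} → d + t ≡ s → ℓ ∣ d → s ~ t
  ∣⇒~ {t = t} refl ℓ∣d = %-remove-+ˡ t ℓ∣d

  ~⇒∣ : ∀ {s t d} → d + t ≡ s → s ~ t → ℓ ∣ d
  ~⇒∣ {t = t} {d} refl eq = subst (ℓ ∣_) (m+n∸n≡m d t) (~⇒∣∸ eq)

  ~⇒+≤ : ∀ {s t} → s < t → t ~ s → s + ℓ ≤ t
  ~⇒+≤ {s} {t} s<t eq with m≤n⇒∃[o]m+o≡n (<⇒≤ s<t)
  ... | zero , refl = ⊥-elim (<-irrefl (sym (+-identityʳ s)) s<t)
  ... | suc d , refl = +-monoʳ-≤ s (∣⇒≤ (~⇒∣ (+-comm (suc d) s) eq))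

  module _ (1<ℓ : 1 < ℓ) where
    ≁suc : ∀ {s} → ¬ (s ~ suc s)
    ≁suc {s} eq = <⇒≱ 1<ℓ (∣⇒≤ (~⇒∣ {d = 1} refl (sym eq)))

≤-distinct : ∀ (w : ℕ → Bool) {v b} → w v ≡ false → w b ≡ true → v ≤ b → v < b
≤-distinct w wv wb v≤b = ≤∧≢⇒< v≤b λ { refl → contradiction (trans (sym wv) wb) (λ ()) }

module Words (ℓ : ℕ) .{{_ : NonZero ℓ}} (1<ℓ : 1 < ℓ) where

  open Runners ℓ

  -- In the forbidden configuration of `IsJM`, `b` and `b′` are the beads of its two rows, `v` and
  -- `v′` the gaps of its two columns. The three inequalities say that the boxes `(b , v)`,
  -- `(b , v′)`, `(b′ , v)` lie in the diagram.
  JM : (ℕ → Bool) → Set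
  JM w = ∀ b v v′ b′ → w b ≡ true → w v ≡ false → w v′ ≡ false → w b′ ≡ true →
         v < b → v′ < b → v < b′ → b ~ v → ¬ (v′ ~ b) → ¬ (b′ ~ b) → ⊥

  JM-cong : ∀ {w w′} → (∀ s → w s ≡ w′ s) → JM w → JM w′
  JM-cong eq jm b v v′ b′ p q r s =
    jm b v v′ b′ (trans (eq b) p) (trans (eq v) q) (trans (eq v′) r) (trans (eq b′) s)

  -- Sliding the beads of one runner down

  before-bead : (ℕ → Bool) → ℕ → Bool
  before-bead w zero    = true
  before-bead w (suc s) = w s

  -- On each pair `s`, `s + 1` with `s + 1` on runner `i`, the two letters are sorted so that a bead
  -- precedes a gap. If position 0 is on runner `i`, its partner is the bead at -1, as all negative
  -- positions count as beads.
  strip : ℕ → (ℕ → Bool) → ℕ → Bool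
  strip i w s =
    if does (s % ℓ ≟ i) then w s ∧ before-bead w s
    else if does (suc s % ℓ ≟ i) then w s ∨ w (suc s)
    else w s

  module Strip (i : ℕ) where

    Top Bottom Neutral : ℕ → Set
    Top s = s % ℓ ≡ i
    Bottom s = Top (suc s)
    Neutral s = ¬ Top s × ¬ Bottom s

    data Class (s : ℕ) : Set where
      top     : Top s → Class s
      bottom  : Bottom s → Class s
      neutral : Neutral s → Class s

    classify : ∀ s → Class s
    classify s with s % ℓ ≟ i | suc s % ℓ ≟ i
    ... | yes t | _     = top t
    ... | no _  | yes u = bottom u
    ... | no t  | no u  = neutral (t , u)

    top⇒¬bottom : ∀ {s} → Top s → ¬ Bottom s
    top⇒¬bottom t u = ≁suc 1<ℓ (trans t (sym u))

    top-~ : ∀ {s t} → Top s → Top t → s ~ t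
    top-~ p q = trans p (sym q)

    bottom-~ : ∀ {s t} → Bottom s → Bottom t → s ~ t
    bottom-~ p q = ~-suc⁻¹ (top-~ p q)

    neutral-~ : ∀ {s t} → Neutral s → s ~ t → Neutral t
    neutral-~ (¬t , ¬u) s~t = (λ t → ¬t (trans s~t t)) , λ u → ¬u (trans (~-suc s~t) u)

    strip-top : ∀ w {s} → Top s → strip i w s ≡ w s ∧ before-bead w s
    strip-top w {s} t rewrite dec-true (s % ℓ ≟ i) t = refl

    strip-bottom : ∀ w {s} → Bottom s → strip i w s ≡ w s ∨ w (suc s)
    strip-bottom w {s} u
      rewrite dec-false (s % ℓ ≟ i) (λ t → top⇒¬bottom t u) | dec-true (suc s % ℓ ≟ i) u = refl

    strip-neutral : ∀ w {s} → Neutral s → strip i w s ≡ w s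
    strip-neutral w {s} (¬t , ¬u)
      rewrite dec-false (s % ℓ ≟ i) ¬t | dec-false (suc s % ℓ ≟ i) ¬u = refl

    module _ {w : ℕ → Bool} where

      bead-top : ∀ {s} → Top s → strip i w s ≡ true → w s ≡ true × before-bead w s ≡ true
      bead-top {s} t e = ∧-conicalˡ _ _ e′ , ∧-conicalʳ (w s) _ e′
        where e′ = trans (sym (strip-top w t)) e

      bead-bottom : ∀ {s} → Bottom s → strip i w s ≡ true → w s ≡ true ⊎ w (suc s) ≡ true
      bead-bottom {s} u e with w s | trans (sym (strip-bottom w u)) e
      ... | true  | _  = inj₁ refl
      ... | false | e′ = inj₂ e′

      gap-bottom : ∀ {s} → Bottom s → strip i w s ≡ false → w s ≡ false × w (suc s) ≡ false
      gap-bottom {s} u e = ∨-conicalˡ _ _ e′ , ∨-conicalʳ (w s) _ e′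
        where e′ = trans (sym (strip-bottom w u)) e

      gap-top : ∀ {s} → Top s → strip i w s ≡ false →
                w s ≡ false ⊎ (∃[ p ] s ≡ suc p × w p ≡ false)
      gap-top {s} t e with w s | trans (sym (strip-top w t)) e
      gap-top {s}     t e | false | _  = inj₁ refl
      gap-top {suc p} t e | true  | e′ = inj₂ (p , refl , e′)

      -- A forbidden quadruple of `strip i w` is turned into one of `w`, according to the runner of
      -- `b`. A bead surviving on runner `i` has a bead right below it in `w`, and a gap surviving
      -- on runner `i - 1` has a gap right above it; these neighbours serve as off-runner witnesses.
      strip-JM : JM w → JM (strip i w)
      strip-JM jm b v v′ b′ B V V′ B′ v<b v′<b v<b′ b~v v′≁b b′≁b with classify b
      -- `b` and `v` are untouched by stripping. If `v′` or `b′` was changed, its partner in the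
      -- pair replaces it, and the partner is off the runner of `b` because `b` is neither `Top` nor
      -- `Bottom`.
      ... | neutral nb@(¬tb , ¬ub) with pull-gap | pull-bead
        where
        pull-gap : ∃[ s ] w s ≡ false × s < b × ¬ (s ~ b)
        pull-gap with classify v′
        ... | bottom u  = v′ , proj₁ (gap-bottom u V′) , v′<b , v′≁b
        ... | neutral n = v′ , trans (sym (strip-neutral w n)) V′ , v′<b , v′≁b
        ... | top t with gap-top t V′
        ... | inj₁ e              = v′ , e , v′<b , v′≁b
        ... | inj₂ (p , refl , e) = p , e , <-trans (n<1+n p) v′<b ,
                                    λ p~b → ¬ub (trans (sym (~-suc p~b)) t)

        pull-bead : ∃[ s ] w s ≡ true × v < s × ¬ (s ~ b)
        pull-bead with classify b′
        ... | top t     = b′ , proj₁ (bead-top t B′) , v<b′ , b′≁b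
        ... | neutral n = b′ , trans (sym (strip-neutral w n)) B′ , v<b′ , b′≁b
        ... | bottom u with bead-bottom u B′
        ... | inj₁ e = b′ , e , v<b′ , b′≁b
        ... | inj₂ e = suc b′ , e , m<n⇒m<1+n v<b′ , λ eq → ¬tb (trans (sym eq) u)

      ... | v″ , g , v″<b , v″≁b | b″ , h , v<b″ , b″≁b =
        jm b v v″ b″ (trans (sym (strip-neutral w nb)) B)
                     (trans (sym (strip-neutral w (neutral-~ nb b~v))) V)
                     g h v<b v″<b v<b″ b~v v″≁b b″≁b
      strip-JM jm (suc p) v v′ b′ B V V′ B′ v<b v′<b v<b′ b~v v′≁b b′≁b | top tb
        with bead-top tb B | gap-top (trans (sym b~v) tb) V | classify v′
      ... | _ , _ | _ | top t = v′≁b (top-~ t tb)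
      ... | wb , wp | inj₁ wv | bottom u =
        jm (suc p) v v′ p wb wv (proj₁ (gap-bottom u V′)) wp v<b v′<b
           (≤-distinct w wv wp (≤-pred v<b)) b~v v′≁b (≁suc 1<ℓ)
      ... | wb , wp | inj₁ wv | neutral n =
        jm (suc p) v v′ p wb wv (trans (sym (strip-neutral w n)) V′) wp v<b v′<b
           (≤-distinct w wv wp (≤-pred v<b)) b~v v′≁b (≁suc 1<ℓ)
      -- The gap at `v` may be due to a bead that slid down to `u`. The configuration moves one step
      -- down, to the bead `p` and the gap `u`, and `p + 1` becomes the off-runner bead.
      ... | wb , wp | inj₂ (u , refl , wu) | bottom q =
        let wv′ , wsv′ = gap-bottom q V′ in
        jm p u (suc v′) (suc p) wp wu wsv′ wb (≤-pred v<b)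
           (≤-distinct w wsv′ wp (≤-distinct w wv′ wp (≤-pred v′<b)))
           (<-trans (n<1+n u) v<b) (~-suc⁻¹ b~v)
           (λ e → ≁suc 1<ℓ (trans (sym e) (top-~ q tb))) (≁suc 1<ℓ ∘ sym)
      ... | wb , wp | inj₂ (u , refl , wu) | neutral n@(_ , ¬q) =
        let wv′ = trans (sym (strip-neutral w n)) V′ in
        jm p u v′ (suc p) wp wu wv′ wb (≤-pred v<b)
           (≤-distinct w wv′ wp (≤-pred v′<b))
           (<-trans (n<1+n u) v<b) (~-suc⁻¹ b~v)
           (λ e → ¬q (trans (~-suc e) tb)) (≁suc 1<ℓ ∘ sym)
      strip-JM jm b v v′ b′ B V V′ B′ v<b v′<b v<b′ b~v v′≁b b′≁b | bottom ub
        with bead-bottom ub B | gap-bottom (trans (sym (~-suc b~v)) ub) V | classify b′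
      ... | _ | _ | bottom u = b′≁b (bottom-~ u ub)
      ... | inj₁ wb | wv , wsv | top t =
        jm b v (suc v) b′ wb wv wsv (proj₁ (bead-top t B′)) v<b (≤-distinct w wsv wb v<b) v<b′ b~v
           (λ e → ≁suc 1<ℓ (trans (sym b~v) (sym e))) b′≁b
      ... | inj₁ wb | wv , wsv | neutral n =
        jm b v (suc v) b′ wb wv wsv (trans (sym (strip-neutral w n)) B′) v<b (≤-distinct w wsv wb v<b) v<b′ b~v
           (λ e → ≁suc 1<ℓ (trans (sym b~v) (sym e))) b′≁b
      -- The bead at `b` may have slid down from `b + 1`. The configuration moves one step up, to
      -- the bead `b + 1` and the gap `v + 1`, and `v` becomes the off-runner gap.
      strip-JM jm b v v′ (suc p) B V V′ B′ v<b v′<b v<b′ b~v v′≁b b′≁b | bottom ub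
          | inj₂ wsb | wv , wsv | top t =
        let wp = proj₂ (bead-top t B′) in
        jm (suc b) (suc v) v p wsb wsv wv wp (s≤s v<b) (m<n⇒m<1+n v<b)
           (≤-distinct w wsv wp (≤-distinct w wv wp (≤-pred v<b′))) (~-suc b~v)
           (λ e → ≁suc 1<ℓ (trans b~v e))
           (λ e → ≁suc 1<ℓ (trans e (top-~ ub t)))
      strip-JM jm b v v′ b′ B V V′ B′ v<b v′<b v<b′ b~v v′≁b b′≁b | bottom ub
          | inj₂ wsb | wv , wsv | neutral n@(¬t , _) =
        let wb′ = trans (sym (strip-neutral w n)) B′ in
        jm (suc b) (suc v) v b′ wsb wsv wv wb′ (s≤s v<b) (m<n⇒m<1+n v<b)
           (≤-distinct w wsv wb′ v<b′) (~-suc b~v)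
           (λ e → ≁suc 1<ℓ (trans b~v e))
           (λ e → ¬t (trans e ub))

    record Slide (w w′ : ℕ → Bool) : Set where
      field
        p       : ℕ
        at-top  : Bottom p
        w-gap   : w p ≡ false
        w-bead  : w (suc p) ≡ true
        w′-bead : w′ p ≡ true
        w′-gap  : w′ (suc p) ≡ false
        w-else  : ∀ s → s ≢ p → s ≢ suc p → w s ≡ w′ s

    -- Sorting a pair depends only on how many beads it holds, and a slide exchanges the two letters
    -- of one pair. So `i`-boxes can be removed one at a time without changing the stripped word.
    strip-slide : ∀ {w w′} → Slide w w′ → ∀ s → strip i w s ≡ strip i w′ s
    strip-slide {w} {w′} sl s with classify s
    ... | neutral n@(¬t , ¬u) =
      trans (strip-neutral w n) (trans (w-else s (λ { refl → ¬u at-top }) (λ { refl → ¬t at-top }))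
                                       (sym (strip-neutral w′ n)))
      where open Slide sl
    strip-slide {w} {w′} sl zero | top t =
      trans (strip-top w t) (trans (cong (_∧ true) (w-else 0 (λ { refl → top⇒¬bottom t at-top }) (λ ())))
                                   (sym (strip-top w′ t)))
      where open Slide sl
    strip-slide {w} {w′} sl (suc u) | top t = trans (strip-top w t) (trans eq (sym (strip-top w′ t)))
      where
      open Slide sl
      eq : w (suc u) ∧ w u ≡ w′ (suc u) ∧ w′ u
      eq with u ≟ p
      ... | yes refl rewrite w-gap | w-bead | w′-gap = refl
      ... | no u≢p = cong₂ _∧_ (w-else (suc u) (λ { refl → top⇒¬bottom t at-top }) (u≢p ∘ suc-injective))
                               (w-else u u≢p λ { refl → top⇒¬bottom at-top t })
    strip-slide {w} {w′} sl s | bottom u = trans (strip-bottom w u) (trans eq (sym (strip-bottom w′ u)))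
      where
      open Slide sl
      eq : w s ∨ w (suc s) ≡ w′ s ∨ w′ (suc s)
      eq with s ≟ p
      ... | yes refl rewrite w-gap | w-bead | w′-bead = refl
      ... | no s≢p = cong₂ _∨_ (w-else s s≢p λ { refl → top⇒¬bottom at-top u })
                               (w-else (suc s) (λ { refl → top⇒¬bottom u at-top }) (s≢p ∘ suc-injective))

    strip-fixed : ∀ {w} → w 0 ≡ true →
                  (∀ p → Bottom p → w p ≡ false → w (suc p) ≡ true → ⊥) → ∀ s → strip i w s ≡ w s
    strip-fixed {w} w0 none s with classify s
    ... | neutral n = strip-neutral w n
    strip-fixed {w} w0 none zero | top t = trans (strip-top w t) (trans (cong (_∧ true) w0) (sym w0))
    strip-fixed {w} w0 none (suc p) | top t = trans (strip-top w t) eq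
      where
      eq : w (suc p) ∧ w p ≡ w (suc p)
      eq with w (suc p) in e | w p in e′
      ... | true  | true  = refl
      ... | true  | false = ⊥-elim (none p t e′ e)
      ... | false | _     = refl
    strip-fixed {w} w0 none s | bottom u = trans (strip-bottom w u) eq
      where
      eq : w s ∨ w (suc s) ≡ w s
      eq with w s in e | w (suc s) in e′
      ... | true  | _     = refl
      ... | false | true  = ⊥-elim (none s u e e′)
      ... | false | false = refl

-- The word of a partition

Descending : List ℕ → Set
Descending = Linked (λ a b → b ≤ a)

row-head : ∀ {p ps} → Descending (p ∷ ps) → row ps 1 ≤ p
row-head [-]       = z≤n
row-head (q≤p ∷ _) = q≤p

row-suc : ∀ {ps} → Descending ps → ∀ a → row ps (2 + a) ≤ row ps (1 + a)
row-suc {[]}     _ _       = z≤n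
row-suc {p ∷ ps} d zero    = row-head d
row-suc {p ∷ ps} d (suc a) = row-suc (tail d) a

row-antitone : ∀ {ps} → Descending ps → ∀ {a b} → a ≤ b → row ps (suc b) ≤ row ps (suc a)
row-antitone {ps} d a≤b = go (≤⇒≤′ a≤b)
  where
  go : ∀ {a b} → a ≤′ b → row ps (suc b) ≤ row ps (suc a)
  go ≤′-refl         = ≤-refl
  go (≤′-step a≤′b)  = ≤-trans (row-suc d _) (go a≤′b)

row-beyond : ∀ ps {a} → length ps ≤ a → row ps (suc a) ≡ 0
row-beyond []       _                   = refl
row-beyond (_ ∷ ps) (s≤s len≤a)         = row-beyond ps len≤a

row>0⇒<length : ∀ ps {a} → 0 < row ps (suc a) → a < length ps
row>0⇒<length ps 0<r = ≰⇒> λ len≤a → <⇒≢ 0<r (sym (row-beyond ps len≤a))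

col≤length : ∀ ps c → col ps c ≤ length ps
col≤length []       c = z≤n
col≤length (p ∷ ps) c with c <ᵇ suc p
... | true  = s≤s (col≤length ps c)
... | false = m≤n⇒m≤1+n (col≤length ps c)

-- As the rows are weakly decreasing, those counted by `col` form an initial segment. The converse
-- is stated for column `c + 1`: at column 0 the empty rows would meet the bound without being
-- counted.
col⇒row : ∀ ps {a c} → Descending ps → suc a ≤ col ps c → c ≤ row ps (suc a)
row⇒col : ∀ ps {a c} → Descending ps → suc c ≤ row ps (suc a) → suc a ≤ col ps (suc c)

col⇒row (p ∷ ps) {a} {c} d le with c ≤? p
col⇒row (p ∷ ps) {zero}  {c} d le | yes c≤p = c≤p
col⇒row (p ∷ ps) {suc a} {c} d le | yes c≤p
  rewrite dec-true (c <? suc p) (s≤s c≤p) = col⇒row ps (tail d) (≤-pred le)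
... | no c≰p rewrite dec-false (c <? suc p) (c≰p ∘ ≤-pred) =
  contradiction (≤-trans (col⇒row ps {0} (tail d) (≤-trans (s≤s z≤n) le)) (row-head d)) c≰p

row⇒col (p ∷ ps) {a} {c} d le
  rewrite dec-true (suc c <? suc p) (s≤s (≤-trans le (row-antitone d {0} {a} z≤n))) = go a le
  where
  go : ∀ a → suc c ≤ row (p ∷ ps) (suc a) → suc a ≤ suc (col ps (suc c))
  go zero    _  = s≤s z≤n
  go (suc a) le = s≤s (row⇒col ps (tail d) le)

does-true⁻¹ : ∀ {P : Set} (P? : Dec P) → does P? ≡ true → P
does-true⁻¹ (yes p) _ = p

-- The division of `y - x` by `ℓ` takes place in ℤ. `conclude` carries its identity over to ℕ,
-- placing the multiple of `ℓ` on one side or the other according to the sign of the quotient.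
residue-% : ∀ ℓ .{{_ : NonZero ℓ}} {N s x y} → ℓ ∣ N → s + x ≡ y + N → residue ℓ x y ≡ s % ℓ
residue-% ℓ@(suc k) {s = s} {x} {y} (divides M refl) eq = conclude (z ℤᵈ./ℕ ℓ) (ℤᵈ.a≡a%ℕn+[a/ℕn]*n z ℓ)
  where
  open ℤ using (+_; -[1+_])
  z = + y ℤ.- + x
  r = z ℤᵈ.%ℕ ℓ

  r<ℓ : r < ℓ
  r<ℓ = ℤᵈ.n%ℕd<d z ℓ

  +-sub : + y ≡ z ℤ.+ + x
  +-sub = sym (trans (ℤₚ.+-assoc (+ y) (ℤ.- + x) (+ x))
              (trans (cong (ℤ._+_ (+ y)) (ℤₚ.+-inverseˡ (+ x))) (ℤₚ.+-identityʳ (+ y))))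

  conclude : ∀ q → z ≡ + r ℤ.+ q ℤ.* + ℓ → r ≡ s % ℓ
  conclude (+ q) e = sym (begin
    s % ℓ                   ≡⟨ cong (_% ℓ) (+-cancelʳ-≡ x s _ (trans eq (trans (cong (_+ M * ℓ) y≡) (rearr r (q * ℓ) x (M * ℓ))))) ⟩
    (r + q * ℓ + M * ℓ) % ℓ ≡⟨ [m+kn]%n≡m%n (r + q * ℓ) M ℓ ⟩
    (r + q * ℓ) % ℓ         ≡⟨ [m+kn]%n≡m%n r q ℓ ⟩
    r % ℓ                   ≡⟨ m<n⇒m%n≡m r<ℓ ⟩
    r                       ∎)
    where
    open ≡-Reasoning
    y≡ : y ≡ r + q * ℓ + x
    y≡ = ℤₚ.+-injective (trans +-sub (cong (ℤ._+ + x) (trans e (cong (ℤ._+_ (+ r)) (sym (ℤₚ.pos-* q ℓ))))))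
    rearr : ∀ r a x b → r + a + x + b ≡ r + a + b + x
    rearr = solve-∀
  conclude -[1+ q ] e = begin
    r                       ≡⟨ sym (m<n⇒m%n≡m r<ℓ) ⟩
    r % ℓ                   ≡⟨ sym ([m+kn]%n≡m%n r M ℓ) ⟩
    (r + M * ℓ) % ℓ         ≡⟨ cong (_% ℓ) (+-cancelʳ-≡ x (r + M * ℓ) _ r+N) ⟩
    (s + suc q * ℓ) % ℓ     ≡⟨ [m+kn]%n≡m%n s (suc q) ℓ ⟩
    s % ℓ                   ∎
    where
    open ≡-Reasoning
    cancel-neg : z ℤ.+ + (suc q * ℓ) ≡ + r
    cancel-neg = trans (cong₂ ℤ._+_ e (ℤₚ.pos-* (suc q) ℓ))
      (trans (ℤₚ.+-assoc (+ r) (-[1+ q ] ℤ.* + ℓ) (+ suc q ℤ.* + ℓ))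
      (trans (cong (ℤ._+_ (+ r)) (trans (sym (ℤₚ.*-distribʳ-+ (+ ℓ) -[1+ q ] (+ suc q)))
                                   (cong (ℤ._* + ℓ) (ℤₚ.+-inverseˡ (+ suc q)))))
             (ℤₚ.+-identityʳ (+ r))))
    r+x : r + x ≡ y + suc q * ℓ
    r+x = ℤₚ.+-injective (trans (cong (ℤ._+ + x) (sym cancel-neg))
      (trans (ℤₚ.+-assoc z _ _) (trans (cong (ℤ._+_ z) (ℤₚ.+-comm (+ (suc q * ℓ)) (+ x)))
      (trans (sym (ℤₚ.+-assoc z _ _)) (cong (ℤ._+ + (suc q * ℓ)) (sym +-sub))))))
    rearr : ∀ y a b → y + a + b ≡ y + b + a
    rearr = solve-∀
    r+N : r + M * ℓ + x ≡ s + suc q * ℓ + x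
    r+N = trans (rearr r (M * ℓ) x) (trans (cong (_+ M * ℓ) r+x)
         (trans (rearr y (suc q * ℓ) (M * ℓ)) (trans (cong (_+ suc q * ℓ) (sym eq)) (rearr s x (suc q * ℓ)))))

Removable Addable : List ℕ → ℕ → Set
Removable ps a = row ps (2 + a) < row ps (1 + a)
Addable   ps z = z ≡ 0 ⊎ row ps (suc z) < row ps z

removableNode addableNode : List ℕ → ℕ → Node
removableNode ps a = node (suc a) (row ps (suc a)) minus
addableNode   ps z = node (suc z) (suc (row ps (suc z))) plus

addable≤length : ∀ ps {z} → Addable ps z → z ≤ length ps
addable≤length ps (inj₁ refl) = z≤n
addable≤length ps {suc z} (inj₂ lt) = row>0⇒<length ps (≤-<-trans z≤n lt)

-- Beads, gaps and hooks

module Abacus (N : ℕ) where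

  -- Here a and c number rows and columns from 0, while Defs numbers them from 1.
  Bead Gap : List ℕ → ℕ → ℕ → Set
  Bead ps s a = s + suc a ≡ row ps (suc a) + N
  Gap  ps v c = v + col ps (suc c) ≡ c + N

  -- When `N` is at least the number of rows, the rows `a < N` suffice: the empty ones among them
  -- fill the lowest positions, and all later rows would have negative ones.
  word : List ℕ → ℕ → Bool
  word ps s = does (anyUpTo? (λ a → s + suc a ≟ row ps (suc a) + N) N)

  word⇒bead : ∀ ps {s} → word ps s ≡ true → ∃[ a ] a < N × Bead ps s a
  word⇒bead ps {s} = does-true⁻¹ (anyUpTo? (λ a → s + suc a ≟ row ps (suc a) + N) N)

  bead⇒word : ∀ ps {s a} → a < N → Bead ps s a → word ps s ≡ true
  bead⇒word ps {s} a<N be = dec-true (anyUpTo? (λ a → s + suc a ≟ row ps (suc a) + N) N) (_ , a<N , be)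

  word-false : ∀ ps {s} → (∀ a → a < N → ¬ Bead ps s a) → word ps s ≡ false
  word-false ps {s} none = dec-false (anyUpTo? (λ a → s + suc a ≟ row ps (suc a) + N) N)
                                     (λ (a , a<N , be) → none a a<N be)

  bead-exists : ∀ ps {a} → a < N → ∃[ s ] Bead ps s a
  bead-exists ps {a} a<N = _ , m∸n+n≡m (≤-trans a<N (m≤n+m N _))

  module _ {ps : List ℕ} (desc : Descending ps) where

    bead-antitone : ∀ {s t a b} → Bead ps s a → Bead ps t b → a < b → t < s
    bead-antitone {s} {t} {a} {b} es et a<b = +-cancelʳ-< (suc a) t s (begin-strict
      t + suc a           <⟨ +-monoʳ-< t (s≤s a<b) ⟩
      t + suc b           ≡⟨ et ⟩
      row ps (suc b) + N  ≤⟨ +-monoˡ-≤ N (row-antitone desc (<⇒≤ a<b)) ⟩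
      row ps (suc a) + N  ≡⟨ sym es ⟩
      s + suc a           ∎)
      where open ≤-Reasoning

    -- In `s - v = (row - c) + (col - a) - 1` both brackets are positive when the box lies in the
    -- diagram and both are at most 0 otherwise, so the sign of `s - v` detects the box.
    box⇒gap<bead : ∀ {s v a c} → Bead ps s a → Gap ps v c → suc c ≤ row ps (suc a) → v < s
    box⇒gap<bead {s} {v} {a} {c} es ev c<r = +-cancelʳ-< (col ps (suc c)) v s (begin-strict
      v + col ps (suc c)   ≡⟨ ev ⟩
      c + N                <⟨ +-monoˡ-< N c<r ⟩
      row ps (suc a) + N   ≡⟨ sym es ⟩
      s + suc a            ≤⟨ +-monoʳ-≤ s (row⇒col ps desc c<r) ⟩
      s + col ps (suc c)   ∎)
      where open ≤-Reasoning

    ¬box⇒bead<gap : ∀ {s v a c} → Bead ps s a → Gap ps v c → row ps (suc a) ≤ c → s < v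
    ¬box⇒bead<gap {s} {v} {a} {c} es ev r≤c = +-cancelʳ-< a s v (begin-strict
      s + a                <⟨ +-monoʳ-< s (n<1+n a) ⟩
      s + suc a            ≡⟨ es ⟩
      row ps (suc a) + N   ≤⟨ +-monoˡ-≤ N r≤c ⟩
      c + N                ≡⟨ sym ev ⟩
      v + col ps (suc c)   ≤⟨ +-monoʳ-≤ v (≮⇒≥ λ lt → <⇒≱ (s≤s r≤c) (col⇒row ps desc lt)) ⟩
      v + a                ∎)
      where open ≤-Reasoning

    gap<bead⇒box : ∀ {s v a c} → Bead ps s a → Gap ps v c → v < s → suc c ≤ row ps (suc a)
    gap<bead⇒box es ev v<s = ≰⇒> λ r≤c → <-asym v<s (¬box⇒bead<gap es ev r≤c)

    gap⇒word : ∀ {v c} → Gap ps v c → word ps v ≡ false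
    gap⇒word {v} {c} ev = word-false ps λ a _ be → separate a be
      where
      separate : ∀ a → ¬ Bead ps v a
      separate a be with suc c ≤? row ps (suc a)
      ... | yes c<r = <-irrefl refl (box⇒gap<bead be ev c<r)
      ... | no c≮r  = <-irrefl refl (¬box⇒bead<gap be ev (≤-pred (≰⇒> c≮r)))

    -- `scan` goes down the rows while their beads stay above `v`. If the bead of row `m + 1` is the
    -- first below `v`, then column `c` with `v + m ≡ c + N` has length `m`, and `v` is its gap. Row
    -- `N` is empty with its bead at 0, so such a row is met.
    word⇒gap : ∀ {v} → length ps < N → word ps v ≡ false → ∃[ c ] Gap ps v c
    word⇒gap {v} len<N wv with scan N ≤-refl
      where
      scan : ∀ m → m ≤ N → (∃[ c ] Gap ps v c) ⊎ (1 ≤ m → v + m < row ps m + N)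
      scan zero    _   = inj₂ λ ()
      scan (suc m) m<N with scan m (<⇒≤ m<N)
      ... | inj₁ found = inj₁ found
      ... | inj₂ above with <-cmp (v + suc m) (row ps (suc m) + N)
      ... | tri< lt _ _ = inj₂ λ _ → lt
      ... | tri≈ _ eq _ = contradiction (trans (sym wv) (bead⇒word ps m<N eq)) λ ()
      ... | tri> _ _ gt = inj₁ (c , trans (cong (v +_) col≡m) v+m)
        where
        r+N≤v+m : row ps (suc m) + N ≤ v + m
        r+N≤v+m = ≤-pred (subst (row ps (suc m) + N <_) (+-suc v m) gt)
        c = v + m ∸ N
        v+m : v + m ≡ c + N
        v+m = sym (m∸n+n≡m (≤-trans (m≤n+m N _) r+N≤v+m))
        r≤c : row ps (suc m) ≤ c
        r≤c = +-cancelʳ-≤ N _ _ (subst (row ps (suc m) + N ≤_) v+m r+N≤v+m)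
        below : ∀ m → (1 ≤ m → v + m < row ps m + N) → v + m ≡ c + N → m ≤ col ps (suc c)
        below zero    _     _ = z≤n
        below (suc m) above e =
          row⇒col ps desc (+-cancelʳ-< N c _ (subst (_< row ps (suc m) + N) e (above (s≤s z≤n))))
        col≡m : col ps (suc c) ≡ m
        col≡m = ≤-antisym (≮⇒≥ λ lt → <⇒≱ (s≤s r≤c) (col⇒row ps desc lt)) (below m above v+m)
    ... | inj₁ found = found
    ... | inj₂ above = ⊥-elim (<⇒≱ (above (≤-trans (s≤s z≤n) len<N))
                                    (subst (λ r → r + N ≤ v + N) (sym (rowN N len<N)) (m≤n+m N v)))
      where
      rowN : ∀ m → length ps < m → row ps m ≡ 0
      rowN (suc m) (s≤s le) = row-beyond ps le

    hook-word : ∀ {s v a c} → Bead ps s a → Gap ps v c → v < s → hook ps (suc a) (suc c) + v ≡ s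
    hook-word {s} {v} {a} {c} es ev v<s = +-cancelʳ-≡ K _ s (begin
      (R ∸ suc c) + (K ∸ suc a) + 1 + v + K           ≡⟨ shuffle (R ∸ suc c) (K ∸ suc a) v K ⟩
      (R ∸ suc c) + (K ∸ suc a) + 1 + (v + K)         ≡⟨ cong ((R ∸ suc c) + (K ∸ suc a) + 1 +_) ev ⟩
      (R ∸ suc c) + (K ∸ suc a) + 1 + (c + N)         ≡⟨ shuffle′ (R ∸ suc c) (K ∸ suc a) c N ⟩
      (R ∸ suc c + suc c) + N + (K ∸ suc a)           ≡⟨ cong (λ r → r + N + (K ∸ suc a)) (m∸n+n≡m c<R) ⟩
      R + N + (K ∸ suc a)                             ≡⟨ cong (_+ (K ∸ suc a)) (sym es) ⟩
      s + suc a + (K ∸ suc a)                         ≡⟨ +-assoc s (suc a) _ ⟩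
      s + (suc a + (K ∸ suc a))                       ≡⟨ cong (s +_) (m+[n∸m]≡n (row⇒col ps desc c<R)) ⟩
      s + K                                           ∎)
      where
      open ≡-Reasoning
      R = row ps (suc a)
      K = col ps (suc c)
      c<R = gap<bead⇒box es ev v<s
      shuffle : ∀ d e v K → d + e + 1 + v + K ≡ d + e + 1 + (v + K)
      shuffle = solve-∀
      shuffle′ : ∀ d e c N → d + e + 1 + (c + N) ≡ (d + suc c) + N + e
      shuffle′ = solve-∀

    -- A bead at `q` would have to come from a row after `a`, but the next row is shorter, which
    -- puts all those beads below `q`.
    removable⇒gap : ∀ {q a} → Removable ps a → Bead ps (suc q) a → word ps q ≡ false
    removable⇒gap {q} {a} rem ea = word-false ps clash
      where
      clash : ∀ b → b < N → ¬ Bead ps q b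
      clash b _ eb with suc a ≤? b
      ... | no ¬a<b with <-cmp a b
      ...   | tri< a<b _ _  = ¬a<b a<b
      ...   | tri≈ _ refl _ = 1+n≢n (+-cancelʳ-≡ (suc a) (suc q) q (trans ea (sym eb)))
      ...   | tri> _ _ b<a  = <-asym (n<1+n q) (bead-antitone eb ea b<a)
      clash b _ eb | yes a<b = <⇒≱ a<b (≤-pred (≤-pred (+-cancelˡ-< q _ _ (begin-strict
        q + suc b            ≡⟨ eb ⟩
        row ps (suc b) + N   ≤⟨ +-monoˡ-≤ N (row-antitone desc a<b) ⟩
        row ps (2 + a) + N   <⟨ +-monoˡ-< N rem ⟩
        row ps (1 + a) + N   ≡⟨ sym ea ⟩
        suc q + suc a        ≡⟨ sym (+-suc q (suc a)) ⟩
        q + suc (suc a)      ∎))))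
        where open ≤-Reasoning

    addable⇒gap : ∀ {p z} → Addable ps z → Bead ps p z → word ps (suc p) ≡ false
    addable⇒gap {p} {z} add ez = word-false ps {suc p} λ b _ → clash add b
      where
      clash : Addable ps z → ∀ b → ¬ Bead ps (suc p) b
      clash add b eb with <-cmp b z | add
      ... | tri≈ _ refl _ | _ = 1+n≢n (+-cancelʳ-≡ (suc z) (suc p) p (trans eb (sym ez)))
      ... | tri> _ _ z<b  | _ = <-asym (n<1+n p) (bead-antitone ez eb z<b)
      ... | tri< b<z _ _  | inj₁ refl = contradiction b<z λ ()
      ... | tri< (s≤s {n = y} b≤y) _ _ | inj₂ lt = flip <⇒≱ (s≤s (s≤s b≤y)) (+-cancelˡ-< p _ _ (begin-strict
        p + suc z                ≡⟨ ez ⟩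
        row ps (suc z) + N       <⟨ +-monoˡ-< N lt ⟩
        row ps (suc y) + N       ≤⟨ +-monoˡ-≤ N (row-antitone desc b≤y) ⟩
        row ps (suc b) + N       ≡⟨ sym eb ⟩
        suc p + suc b            ≡⟨ sym (+-suc p (suc b)) ⟩
        p + suc (suc b)          ∎))
        where open ≤-Reasoning

    gap⇒removable : ∀ {p a} → length ps < N → a < N → Bead ps (suc p) a → word ps p ≡ false → Removable ps a
    gap⇒removable {p} {a} len<N a<N ea wp = ≤∧≢⇒< (row-suc desc a) distinct
      where
      distinct : row ps (2 + a) ≢ row ps (1 + a)
      distinct e = contradiction (trans (sym wp) (bead⇒word ps sa<N bead)) λ ()
        where
        bead : Bead ps p (suc a)
        bead = trans (+-suc p (suc a)) (trans ea (cong (_+ N) (sym e)))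
        -- `word` sees the bead of row `a + 1` only if `a + 1 < N`. Otherwise both rows would be
        -- empty, and the bead of row `a` could not lie as high as `p + 1`.
        sa<N : suc a < N
        sa<N = ≰⇒> λ N≤sa → <⇒≱ (m<n+m (suc a) {suc p} (s≤s z≤n)) (begin
          suc p + suc a        ≡⟨ ea ⟩
          row ps (suc a) + N   ≡⟨ cong (_+ N) (trans (sym e) (row-beyond ps (<⇒≤ (<-≤-trans len<N N≤sa)))) ⟩
          N                    ≤⟨ N≤sa ⟩
          suc a                ∎)
          where open ≤-Reasoning

-- The ladder order

module LadderOrder (ℓ : ℕ) where

  infix 4 _≺_

  _≺_ : Node → Node → Set
  node x y _ ≺ node x′ y′ _ = ladder ℓ x y < ladder ℓ x′ y′ ⊎ (ladder ℓ x y ≡ ladder ℓ x′ y′ × x < x′)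

  ≺-irrefl : ∀ m → ¬ m ≺ m
  ≺-irrefl _ (inj₁ lt)       = <-irrefl refl lt
  ≺-irrefl _ (inj₂ (_ , lt)) = <-irrefl refl lt

  ≺-trans : ∀ m n o → m ≺ n → n ≺ o → m ≺ o
  ≺-trans _ _ _ (inj₁ p)       (inj₁ q)       = inj₁ (<-trans p q)
  ≺-trans _ _ _ (inj₁ p)       (inj₂ (e , _)) = inj₁ (<-≤-trans p (≤-reflexive e))
  ≺-trans _ _ _ (inj₂ (e , _)) (inj₁ q)       = inj₁ (≤-<-trans (≤-reflexive e) q)
  ≺-trans _ _ _ (inj₂ (e , p)) (inj₂ (f , q)) = inj₂ (trans e f , <-trans p q)

  ≺-asym : ∀ m n → m ≺ n → ¬ n ≺ m
  ≺-asym m n m≺n n≺m = ≺-irrefl m (≺-trans m n m m≺n n≺m)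

  ≺-compare : ∀ m n → Node.rx m < Node.rx n → m ≺ n ⊎ n ≺ m
  ≺-compare (node x y _) (node x′ y′ _) x<x′ with <-cmp (ladder ℓ x y) (ladder ℓ x′ y′)
  ... | tri< lt _ _ = inj₁ (inj₁ lt)
  ... | tri≈ _ e _  = inj₁ (inj₂ (e , x<x′))
  ... | tri> _ _ gt = inj₂ (inj₁ gt)

  ≺-≤ : ∀ m n → ladder ℓ (Node.rx m) (Node.ry m) ≤ ladder ℓ (Node.rx n) (Node.ry n) →
        Node.rx m < Node.rx n → m ≺ n
  ≺-≤ _ _ le x<x′ with m≤n⇒m<n∨m≡n le
  ... | inj₁ lt = inj₁ lt
  ... | inj₂ e  = inj₂ (e , x<x′)

  before-true : ∀ m n → m ≺ n → before ℓ m n ≡ true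
  before-true (node x y _) (node x′ y′ _) (inj₁ lt)
    rewrite dec-true (ladder ℓ x y <? ladder ℓ x′ y′) lt = refl
  before-true (node x y _) (node x′ y′ _) (inj₂ (e , lt))
    rewrite dec-false (ladder ℓ x y <? ladder ℓ x′ y′) (<-irrefl e)
          | dec-true (ladder ℓ x y ≟ ladder ℓ x′ y′) e | dec-true (x <? x′) lt = refl

  before-false : ∀ m n → ¬ m ≺ n → before ℓ m n ≡ false
  before-false (node x y _) (node x′ y′ _) ¬lt
    rewrite dec-false (ladder ℓ x y <? ladder ℓ x′ y′) (¬lt ∘ inj₁)
    with ladder ℓ x y ≟ ladder ℓ x′ y′
  ... | no ¬e rewrite dec-false (ladder ℓ x y ≟ ladder ℓ x′ y′) ¬e = refl
  ... | yes e rewrite dec-true (ladder ℓ x y ≟ ladder ℓ x′ y′) e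
                    | dec-false (x <? x′) (λ lt → ¬lt (inj₂ (e , lt))) = refl

nodeResidue : ℕ → Node → ℕ
nodeResidue ℓ n = residue ℓ (Node.rx n) (Node.ry n)

-- In ladder-above and ladder-below, e = ℓ - 1.

ladder-above : ∀ {q p e T N c a z} → q + T * suc e ≤ p → suc q + suc a ≡ suc c + N →
               p + suc z ≡ c + T + N → suc z + e * (c + T) ≤ suc a + e * c
-- The two bead equations give `a - z = (p - q) - T`, which is at least `T * e`: the row difference
-- makes up for the `T` extra columns. Equality is not excluded.
ladder-above {q} {p} {e} {T} {N} {c} {a} {z} le eq ep = +-cancelʳ-≤ (q + T) _ _ (begin
  suc z + e * (c + T) + (q + T)       ≡⟨ rearr₁ z e c T q ⟩
  q + T * suc e + suc z + e * c       ≤⟨ +-monoˡ-≤ (e * c) (+-monoˡ-≤ (suc z) le) ⟩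
  p + suc z + e * c                   ≡⟨ cong (_+ e * c) ep ⟩
  c + T + N + e * c                   ≡⟨ rearr₂ c T N e ⟩
  (c + N) + (T + e * c)               ≡⟨ cong (_+ (T + e * c)) (sym (suc-injective eq)) ⟩
  (q + suc a) + (T + e * c)           ≡⟨ rearr₃ q a T e c ⟩
  suc a + e * c + (q + T)             ∎)
  where
  open ≤-Reasoning
  rearr₁ : ∀ z e c T q → suc z + e * (c + T) + (q + T) ≡ q + T * suc e + suc z + e * c
  rearr₁ = solve-∀
  rearr₂ : ∀ c T N e → c + T + N + e * c ≡ (c + N) + (T + e * c)
  rearr₂ = solve-∀
  rearr₃ : ∀ q a T e c → (q + suc a) + (T + e * c) ≡ suc a + e * c + (q + T)
  rearr₃ = solve-∀

ladder-below : ∀ {q p e t N r r′ a} → suc p + suc t * suc e ≤ suc q → 1 < e →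
               suc q + suc a ≡ suc r + N → p + suc (suc (a + t)) ≡ r′ + N →
               suc (suc (a + t)) + e * r′ < suc a + e * r
ladder-below {q} {p} {e} {t} {N} {r} {r′} {a} le 1<e eq ep = begin-strict
  suc (suc (a + t)) + e * r′       ≡⟨ rearr₁ a t (e * r′) ⟩
  suc a + (e * r′ + suc t * 1)     <⟨ +-monoʳ-< (suc a) (+-monoʳ-< (e * r′) (*-monoʳ-< (suc t) 1<e²)) ⟩
  suc a + (e * r′ + suc t * (e * e)) ≡⟨ rearr₂ a e r′ t ⟩
  suc a + e * (r′ + suc t * e)     ≤⟨ +-monoʳ-≤ (suc a) (*-monoʳ-≤ e r-bound) ⟩
  suc a + e * r                    ∎
  where
  open ≤-Reasoning
  rearr₁ : ∀ a t k → suc (suc (a + t)) + k ≡ suc a + (k + suc t * 1)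
  rearr₁ = solve-∀
  rearr₂ : ∀ a e r t → suc a + (e * r + suc t * (e * e)) ≡ suc a + e * (r + suc t * e)
  rearr₂ = solve-∀
  rearr₃ : ∀ r t e N → r + suc t * e + (N + suc t + 1) ≡ r + N + suc t * suc e + 1
  rearr₃ = solve-∀
  rearr₄ : ∀ p a t k → p + suc (suc (a + t)) + k + 1 ≡ suc p + k + suc a + suc t
  rearr₄ = solve-∀
  rearr₅ : ∀ r N t → suc r + N + suc t ≡ r + (N + suc t + 1)
  rearr₅ = solve-∀
  -- Here `ℓ > 2` enters: `t + 1` further rows raise the ladder number by `t + 1`, while at least
  -- `(t + 1) * e` fewer columns lower it by `(t + 1) * e * e` or more. For `e = 1` the bound would
  -- allow a tie, and ties favour the higher row `a`.
  1<e² : 1 < e * e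
  1<e² = ≤-trans 1<e (m≤m*n e e {{>-nonZero (<-trans (s≤s z≤n) 1<e)}})
  r-bound : r′ + suc t * e ≤ r
  r-bound = +-cancelʳ-≤ (N + suc t + 1) _ _ (begin
    r′ + suc t * e + (N + suc t + 1)             ≡⟨ rearr₃ r′ t e N ⟩
    r′ + N + suc t * suc e + 1                   ≡⟨ cong (λ k → k + suc t * suc e + 1) (sym ep) ⟩
    p + suc (suc (a + t)) + suc t * suc e + 1    ≡⟨ rearr₄ p a t (suc t * suc e) ⟩
    suc p + suc t * suc e + suc a + suc t        ≤⟨ +-monoˡ-≤ (suc t) (+-monoˡ-≤ (suc a) le) ⟩
    suc q + suc a + suc t                        ≡⟨ cong (_+ suc t) eq ⟩
    suc r + N + suc t                            ≡⟨ rearr₅ r N t ⟩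
    r + (N + suc t + 1)                          ∎)

-- Addable boxes precede removable boxes

module JamesMathas (e : ℕ) (1<e : 1 < e) (N : ℕ) (ℓ∣N : suc e ∣ N) where

  private
    ℓ = suc e
    1<ℓ : 1 < ℓ
    1<ℓ = s≤s (<-trans (s≤s z≤n) 1<e)

  open Runners ℓ
  open Words ℓ 1<ℓ
  open Abacus N
  open LadderOrder ℓ

  IsJM⇒JM : ∀ {ps} → Descending ps → length ps < N → IsJM ℓ ps → JM (word ps)
  IsJM⇒JM {ps} desc len<N jm b v v′ b′ B V V′ B′ v<b v′<b v<b′ b~v v′≁b b′≁b
    with word⇒bead ps B | word⇒gap desc len<N V | word⇒gap desc len<N V′ | word⇒bead ps B′
  ... | a , _ , eb | c , ev | c′ , ev′ | a′ , _ , eb′ =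
    jm (suc a , suc c , suc a′ , suc c′ ,
        (s≤s z≤n , s≤s z≤n , gap<bead⇒box desc eb ev v<b) ,
        (s≤s z≤n , s≤s z≤n , gap<bead⇒box desc eb ev′ v′<b) ,
        (s≤s z≤n , s≤s z≤n , gap<bead⇒box desc eb′ ev v<b′) ,
        ~⇒∣ (hook-word desc eb ev v<b) b~v ,
        (λ d → v′≁b (sym (∣⇒~ (hook-word desc eb ev′ v′<b) d))) ,
        λ d → b′≁b (trans (∣⇒~ (hook-word desc eb′ ev v<b′) d) (sym b~v)))

  removable-residue : ∀ ps {s a} → Bead ps s a → nodeResidue ℓ (removableNode ps a) ≡ s % ℓ
  removable-residue ps {s} {a} eb = residue-% ℓ {s = s} {suc a} ℓ∣N eb

  addable-residue : ∀ ps {s a} → Bead ps s a → nodeResidue ℓ (addableNode ps a) ≡ suc s % ℓ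
  addable-residue ps {s} {a} eb = residue-% ℓ {s = suc s} {suc a} ℓ∣N (cong suc eb)

  removable-bead : ∀ ps {a} → length ps < N → Removable ps a → a < N × ∃[ q ] Bead ps (suc q) a
  removable-bead ps {a} len<N rem with bead-exists ps (<-trans (row>0⇒<length ps (≤-<-trans z≤n rem)) len<N)
  ... | suc q , eb = <-trans (row>0⇒<length ps (≤-<-trans z≤n rem)) len<N , q , eb
  ... | zero  , eb = ⊥-elim (<⇒≱ (+-mono-≤-< {1} (≤-<-trans z≤n rem) a<N) (≤-reflexive (sym eb)))
    where a<N = <-trans (row>0⇒<length ps (≤-<-trans z≤n rem)) len<N

  -- Equal residues put `p` and `q` on one runner. The JM condition then confines to a single runner
  -- the gaps between them if `z < a`, and the beads if `a < z`. Being at least `ℓ` apart, these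
  -- force the two boxes far enough apart to decide the ladder order.
  addable≺removable : ∀ {ps a z} → Descending ps → length ps < N → JM (word ps) →
    Removable ps a → Addable ps z →
    nodeResidue ℓ (removableNode ps a) ≡ nodeResidue ℓ (addableNode ps z) →
    addableNode ps z ≺ removableNode ps a
  addable≺removable {ps} {a} {z} desc len<N jm rem add res
    with removable-bead ps len<N rem | bead-exists ps (≤-<-trans (addable≤length ps add) len<N)
  ... | a<N , q , ea | p , ez = by-position (<-cmp z a)
    where
    z<N = ≤-<-trans (addable≤length ps add) len<N
    wa : word ps (suc q) ≡ true
    wa = bead⇒word ps {suc q} a<N ea
    wz : word ps p ≡ true
    wz = bead⇒word ps z<N ez
    gq : word ps q ≡ false
    gq = removable⇒gap desc rem ea
    gp : word ps (suc p) ≡ false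
    gp = addable⇒gap desc add ez
    sq~sp : suc q ~ suc p
    sq~sp = trans (sym (removable-residue ps {suc q} ea)) (trans res (addable-residue ps ez))
    p~q : p ~ q
    p~q = ~-suc⁻¹ (sym sq~sp)

    by-position : _ → addableNode ps z ≺ removableNode ps a
    -- In one row the addable box is right of the removable one, so their residues differ.
    by-position (tri≈ _ refl _) with +-cancelʳ-≡ (suc a) p (suc q) (trans ez (sym ea))
    ... | refl = contradiction (sym p~q) (≁suc 1<ℓ)
    by-position (tri< z<a _ _) with m≤n⇒∃[o]m+o≡n (≤-<-trans z≤n rem)
    -- A weak inequality of ladder numbers is enough, as ties go to the higher row `z`.
    ... | c , Rc = ≺-≤ (addableNode ps z) (removableNode ps a)
                       (subst (λ r → ladder ℓ (suc z) (suc (row ps (suc z))) ≤ ladder ℓ (suc a) r) Rc goal)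
                       (s≤s z<a)
      where
      Ra : row ps (suc a) ≡ suc c
      Ra = sym Rc
      ea′ : suc q + suc a ≡ suc c + N
      ea′ = trans ea (cong (_+ N) Ra)

      q<p : q < p
      q<p = <-trans (n<1+n q) (bead-antitone desc ez ea z<a)

      -- The gap q lies below the bead p on the same runner and the bead q + 1 lies on
      -- another one, so every gap below p is on the runner of p.
      gap~p : ∀ {v} → v < p → word ps v ≡ false → p ~ v
      gap~p {v} v<p gv = sym (decidable-stable (v % ℓ ≟ p % ℓ) λ v≁p →
        jm p q v (suc q) wz gq gv wa q<p v<p (n<1+n q) p~q v≁p λ sq~p → ≁suc 1<ℓ (sym (trans sq~p p~q)))

      -- Column `c` ends in the removable box of row `a`, so its length is `a + 1`.
      gap-q : Gap ps q c
      gap-q = trans (cong (q +_) (≤-antisym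
                (≮⇒≥ λ lt → <⇒≱ rem (≤-trans (≤-reflexive Ra) (col⇒row ps desc lt)))
                (row⇒col ps desc (≤-reflexive (sym Ra)))))
              (suc-injective ea′)

      -- The gaps of the columns from `c` to the end of row `z` climb from `q` towards `p` on one
      -- runner, so each further column costs at least `ℓ`.
      spread : ∀ t → suc (c + t) ≤ row ps (suc z) → ∃[ v ] Gap ps v (c + t) × v < p × q + t * ℓ ≤ v
      spread zero le = q , subst (Gap ps q) (sym (+-identityʳ c)) gap-q , q<p , ≤-reflexive (+-identityʳ q)
      spread (suc t) le with spread t (≤-trans (≤-trans (n≤1+n _) (s≤s (≤-reflexive (sym (+-suc c t))))) le)
      ... | v , ev , v<p , q≤v = v′ , ev′ , v′<p , (begin
          q + (ℓ + t * ℓ)   ≡⟨ cong (q +_) (+-comm ℓ (t * ℓ)) ⟩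
          q + (t * ℓ + ℓ)   ≡⟨ sym (+-assoc q (t * ℓ) ℓ) ⟩
          q + t * ℓ + ℓ     ≤⟨ +-monoˡ-≤ ℓ q≤v ⟩
          v + ℓ             ≤⟨ ~⇒+≤ v<v′ (trans (sym (gap~p v′<p (gap⇒word desc ev′))) (gap~p v<p (gap⇒word desc ev))) ⟩
          v′                ∎)
        where
        open ≤-Reasoning
        col≤N : col ps (suc (c + suc t)) ≤ N
        col≤N = ≤-trans (col≤length ps _) (<⇒≤ len<N)
        v′ = c + suc t + N ∸ col ps (suc (c + suc t))
        ev′ : Gap ps v′ (c + suc t)
        ev′ = m∸n+n≡m (≤-trans col≤N (m≤n+m N _))
        v′<p : v′ < p
        v′<p = box⇒gap<bead desc ez ev′ le
        v<v′ : v < v′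
        v<v′ = +-cancelʳ-< (col ps (suc (c + t))) v v′ (begin-strict
          v + col ps (suc (c + t))        ≡⟨ ev ⟩
          c + t + N                       <⟨ +-monoˡ-< N (+-monoʳ-< c (n<1+n t)) ⟩
          c + suc t + N                   ≡⟨ sym ev′ ⟩
          v′ + col ps (suc (c + suc t))   ≤⟨ +-monoʳ-≤ v′ (col-antitone (+-monoʳ-≤ c (n≤1+n t))) ⟩
          v′ + col ps (suc (c + t))       ∎)
          where
          col-antitone : ∀ {i j} → i ≤ j → col ps (suc j) ≤ col ps (suc i)
          col-antitone {i} {j} i≤j with col ps (suc j) in cj
          ... | zero  = z≤n
          ... | suc k = row⇒col ps desc (≤-trans (s≤s i≤j) (col⇒row ps desc (≤-reflexive (sym cj))))

      goal : ladder ℓ (suc z) (suc (row ps (suc z))) ≤ ladder ℓ (suc a) (suc c)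
      goal with m≤n⇒∃[o]m+o≡n (≤-trans (≤-reflexive (sym Ra)) (row-antitone desc (<⇒≤ z<a)))
      ... | t , eq with spread t (≤-reflexive eq)
      ... | v , ev , v<p , q≤v =
        subst (λ r → suc z + e * r ≤ suc a + e * c) Rz
          (ladder-above {q} {p} {e} {suc t} {N} {c} le ea′ (trans ez (cong (_+ N) (sym Rz))))
        where
        open ≤-Reasoning
        Rz : c + suc t ≡ row ps (suc z)
        Rz = trans (+-suc c t) eq
        le : q + suc t * ℓ ≤ p
        le = begin
          q + (ℓ + t * ℓ)   ≡⟨ cong (q +_) (+-comm ℓ (t * ℓ)) ⟩
          q + (t * ℓ + ℓ)   ≡⟨ sym (+-assoc q (t * ℓ) ℓ) ⟩
          q + t * ℓ + ℓ     ≤⟨ +-monoˡ-≤ ℓ q≤v ⟩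
          v + ℓ             ≤⟨ ~⇒+≤ v<p (gap~p v<p (gap⇒word desc ev)) ⟩
          p                 ∎
    by-position (tri> _ _ a<z) with m≤n⇒∃[o]m+o≡n (≤-<-trans z≤n rem)
    ... | r , Rr = inj₁ (subst (λ y → ladder ℓ (suc z) (suc (row ps (suc z))) < ladder ℓ (suc a) y) Rr goal)
      where
      sp<sq : suc p < suc q
      sp<sq = ≤-distinct (word ps) gp wa (bead-antitone desc ea ez a<z)

      -- The gap `p + 1` lies below the bead `q + 1` on the same runner, and the gap `q` under that
      -- bead is on another one, so every bead above `p + 1` is on the runner of `p + 1`.
      bead~sp : ∀ {s} → suc p < s → word ps s ≡ true → s ~ suc p
      bead~sp {s} sp<s ws = decidable-stable (s % ℓ ≟ suc p % ℓ) λ s≁sp →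
        jm (suc q) (suc p) q s wa gp gq ws sp<sq (n<1+n q) sp<s sq~sp (≁suc 1<ℓ)
           λ s~sq → s≁sp (trans s~sq sq~sp)

      -- Rows `b` to `z - 1` have their beads on one runner above the gap `p + 1`; the induction
      -- climbs from row `z - 1` up to `b`.
      spread : ∀ t {b s} → suc (b + t) ≡ z → Bead ps s b → suc p + suc t * ℓ ≤ s
      spread t {b} {s} eq eb = go t eq
        where
        open ≤-Reasoning
        b<z : b < z
        b<z = subst (b <_) eq (s≤s (m≤m+n b t))
        ws = bead⇒word ps (<-trans b<z z<N) eb
        sp<s : suc p < s
        sp<s = ≤-distinct (word ps) gp ws (bead-antitone desc eb ez b<z)
        go : ∀ t → suc (b + t) ≡ z → suc p + suc t * ℓ ≤ s
        go zero _ = begin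
          suc p + (ℓ + 0)   ≡⟨ cong (suc p +_) (+-identityʳ ℓ) ⟩
          suc p + ℓ         ≤⟨ ~⇒+≤ sp<s (bead~sp sp<s ws) ⟩
          s                 ∎
        go (suc t) eq with bead-exists ps {suc b} sb<N
          where
          sb<N : suc b < N
          sb<N = ≤-<-trans b<z z<N
        ... | s′ , eb′ = begin
          suc p + (ℓ + suc t * ℓ)   ≡⟨ cong (suc p +_) (+-comm ℓ (suc t * ℓ)) ⟩
          suc p + (suc t * ℓ + ℓ)   ≡⟨ sym (+-assoc (suc p) (suc t * ℓ) ℓ) ⟩
          suc p + suc t * ℓ + ℓ     ≤⟨ +-monoˡ-≤ ℓ (spread t (trans (cong suc (sym (+-suc b t))) eq) eb′) ⟩
          s′ + ℓ                    ≤⟨ ~⇒+≤ (bead-antitone desc eb eb′ (n<1+n b)) (trans (bead~sp sp<s ws) (sym s′~sp)) ⟩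
          s                         ∎
          where
          sb<z : suc b < z
          sb<z = subst (suc b <_) (trans (cong suc (sym (+-suc b t))) eq) (s≤s (s≤s (m≤m+n b t)))
          ws′ = bead⇒word ps (<-trans sb<z z<N) eb′
          s′~sp : s′ ~ suc p
          s′~sp = bead~sp (≤-distinct (word ps) gp ws′ (bead-antitone desc eb′ ez sb<z)) ws′

      goal : suc z + e * row ps (suc z) < suc a + e * r
      goal with m≤n⇒∃[o]m+o≡n a<z
      ... | t , refl = ladder-below {q} {p} {e} {t} {N} {r} {row ps (suc z)} {a} (spread t refl ea) 1<e
                         (trans ea (cong (_+ N) (sym Rr))) ez

-- Signatures

module Sorting (ℓ : ℕ) (n : Node) where

  open LadderOrder ℓ

  -- `n` is the box to be added by the operator. Copies of `n` count as low, so lists may repeat it,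
  -- and the order of the low nodes among themselves is left open.
  Low High : Node → Set
  Low m  = m ≡ n ⊎ (Node.sgn m ≡ plus × m ≺ n)
  High m = Node.sgn m ≡ minus × n ≺ m

  data LowsHighs : List Node → Set where
    highs : ∀ {ms} → All High ms → LowsHighs ms
    _∷_   : ∀ {m ms} → Low m → LowsHighs ms → LowsHighs (m ∷ ms)

  data Pivoted : List Node → Set where
    pivot : ∀ {ms} → All High ms → Pivoted (n ∷ ms)
    _∷_   : ∀ {m ms} → Low m → Pivoted ms → Pivoted (m ∷ ms)

  low-high : ∀ m h → Low m → High h → m ≺ h
  low-high _ _ (inj₁ refl)       (_ , n≺h) = n≺h
  low-high m h (inj₂ (_ , m≺n)) (_ , n≺h) = ≺-trans m n h m≺n n≺h

  low-⊀ : ∀ m → Low m → ¬ n ≺ m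
  low-⊀ _ (inj₁ refl)        = ≺-irrefl n
  low-⊀ m (inj₂ (_ , m≺n)) = ≺-asym m n m≺n

  insert-low-highs : ∀ {m ms} → Low m → All High ms → insertN ℓ m ms ≡ m ∷ ms
  insert-low-highs l [] = refl
  insert-low-highs {m} {h ∷ _} l (hi ∷ _) rewrite before-true m h (low-high m h l hi) = refl

  insert-All : ∀ {P : Node → Set} {m ms} → P m → All P ms → All P (insertN ℓ m ms)
  insert-All p [] = p ∷ []
  insert-All {m = m} {k ∷ _} p (q ∷ qs) with before ℓ m k
  ... | true  = p ∷ q ∷ qs
  ... | false = q ∷ insert-All p qs

  insert-low : ∀ {m ms} → Low m → LowsHighs ms → LowsHighs (insertN ℓ m ms)
  insert-low l (highs hs) = subst LowsHighs (sym (insert-low-highs l hs)) (l ∷ highs hs)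
  insert-low {m} {k ∷ _} l (l′ ∷ ls) with before ℓ m k
  ... | true  = l ∷ l′ ∷ ls
  ... | false = l′ ∷ insert-low l ls

  insert-high : ∀ {m ms} → High m → LowsHighs ms → LowsHighs (insertN ℓ m ms)
  insert-high h (highs hs) = highs (insert-All h hs)
  insert-high {m} {k ∷ _} h (l ∷ ls)
    rewrite before-false m k (≺-asym k m (low-high k m l h)) = l ∷ insert-high h ls

  insert-pivot : ∀ {ms} → LowsHighs ms → Pivoted (insertN ℓ n ms)
  insert-pivot (highs hs) = subst Pivoted (sym (insert-low-highs (inj₁ refl) hs)) (pivot hs)
  insert-pivot {k ∷ _} (l ∷ ls) rewrite before-false n k (low-⊀ k l) = l ∷ insert-pivot ls

  insert-low-pivoted : ∀ {m ms} → Low m → Pivoted ms → Pivoted (insertN ℓ m ms)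
  insert-low-pivoted {m} l@(inj₂ (_ , m≺n)) (pivot hs) rewrite before-true m n m≺n = l ∷ pivot hs
  insert-low-pivoted l@(inj₁ refl) (pivot {ms} hs)
    rewrite before-false n n (≺-irrefl n) | insert-low-highs l hs = l ∷ pivot hs
  insert-low-pivoted {m} {k ∷ _} l (l′ ∷ ls) with before ℓ m k
  ... | true  = l ∷ l′ ∷ ls
  ... | false = l′ ∷ insert-low-pivoted l ls

  insert-high-pivoted : ∀ {m ms} → High m → Pivoted ms → Pivoted (insertN ℓ m ms)
  insert-high-pivoted {m} h@(_ , n≺m) (pivot hs)
    rewrite before-false m n (≺-asym n m n≺m) = pivot (insert-All h hs)
  insert-high-pivoted {m} {k ∷ _} h (l ∷ ls)
    rewrite before-false m k (≺-asym k m (low-high k m l h)) = l ∷ insert-high-pivoted h ls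

  sort-LowsHighs : ∀ {ms} → All (λ m → Low m ⊎ High m) ms → LowsHighs (sortN ℓ ms)
  sort-LowsHighs []             = highs []
  sort-LowsHighs (inj₁ l ∷ ms) = insert-low l (sort-LowsHighs ms)
  sort-LowsHighs (inj₂ h ∷ ms) = insert-high h (sort-LowsHighs ms)

  sort-Pivoted : ∀ {ms} → All (λ m → Low m ⊎ High m) ms → n ∈ ms → Pivoted (sortN ℓ ms)
  sort-Pivoted (_ ∷ ms)      (here refl)  = insert-pivot (sort-LowsHighs ms)
  sort-Pivoted (inj₁ l ∷ ms) (there n∈ms) = insert-low-pivoted l (sort-Pivoted ms n∈ms)
  sort-Pivoted (inj₂ h ∷ ms) (there n∈ms) = insert-high-pivoted h (sort-Pivoted ms n∈ms)

  Plus : Node → Set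
  Plus m = Node.sgn m ≡ plus

  step-onto-plus : ∀ {st} → All Plus st → ∀ m → step st m ≡ m ∷ st
  step-onto-plus []                               m = refl
  step-onto-plus {node _ _ plus ∷ _} (refl ∷ _) m = refl

  step-minus : ∀ st {x y} → step st (node x y minus) ≡ node x y minus ∷ st
  step-minus []                   = refl
  step-minus (node _ _ minus ∷ _) = refl
  step-minus (node _ _ plus ∷ _)  = refl

  firstPlus-highs : ∀ st {ms} → All High ms → firstPlus (foldl step st ms) ≡ firstPlus st
  firstPlus-highs st [] = refl
  firstPlus-highs st {node x y minus ∷ _} ((refl , _) ∷ hs) rewrite step-minus st {x} {y} =
    firstPlus-highs (node x y minus ∷ st) hs

  -- No minus is on the stack when a plus arrives, so nothing cancels, and `n` is the last plus
  -- pushed.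
  firstPlus-Pivoted : Plus n → ∀ {st ms} → All Plus st → Pivoted ms → firstPlus (foldl step st ms) ≡ just n
  firstPlus-Pivoted pn {st} ps (pivot hs) rewrite step-onto-plus ps n =
    trans (firstPlus-highs (n ∷ st) hs) (firstPlus-plus pn)
    where
    firstPlus-plus : ∀ {m} → Plus m → firstPlus (m ∷ st) ≡ just m
    firstPlus-plus {node _ _ plus} refl = refl
  firstPlus-Pivoted pn ps (_∷_ {m} l ls) rewrite step-onto-plus ps m =
    firstPlus-Pivoted pn (low-plus l ∷ ps) ls
    where
    low-plus : ∀ {m} → Low m → Plus m
    low-plus (inj₁ refl)     = pn
    low-plus (inj₂ (p , _)) = p

filterRes-All : ∀ ℓ i {P : Node → Set} {ns} → All (λ n → nodeResidue ℓ n ≡ i → P n) ns → All P (filterRes ℓ i ns)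
filterRes-All ℓ i [] = []
filterRes-All ℓ i {ns = n ∷ _} (p ∷ ps) with nodeResidue ℓ n ≟ i
... | yes e rewrite dec-true (nodeResidue ℓ n ≟ i) e = p e ∷ filterRes-All ℓ i ps
... | no ¬e rewrite dec-false (nodeResidue ℓ n ≟ i) ¬e = filterRes-All ℓ i ps

filterRes-∈ : ∀ ℓ i {n ns} → nodeResidue ℓ n ≡ i → n ∈ ns → n ∈ filterRes ℓ i ns
filterRes-∈ ℓ i {n} e (here refl) rewrite dec-true (nodeResidue ℓ n ≟ i) e = here refl
filterRes-∈ ℓ i {ns = m ∷ _} e (there n∈) with nodeResidue ℓ m ≡ᵇ i
... | true  = there (filterRes-∈ ℓ i e n∈)
... | false = filterRes-∈ ℓ i e n∈

allNodes-All : ∀ ps {P : Node → Set} → (∀ a → Removable ps a → P (removableNode ps a)) →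
               (∀ z → Addable ps z → P (addableNode ps z)) → All P (allNodes ps)
allNodes-All ps {P} rem add =
  All.concat⁺ (All.map⁺ (All.universal (λ k → All.++⁺ (removable k) (addable k)) (upTo (suc (length ps)))))
  where
  removable : ∀ k → All P (removableAt ps (suc k))
  removable k with row ps (2 + k) <? row ps (1 + k)
  ... | yes lt rewrite dec-true (row ps (2 + k) <? row ps (1 + k)) lt = rem k lt ∷ []
  ... | no ¬lt rewrite dec-false (row ps (2 + k) <? row ps (1 + k)) ¬lt = []
  addable : ∀ k → All P (addableAt ps (suc k))
  addable zero = add 0 (inj₁ refl) ∷ []
  addable (suc k) with row ps (2 + k) <? row ps (1 + k)
  ... | yes lt rewrite dec-true (row ps (2 + k) <? row ps (1 + k)) lt = add (suc k) (inj₂ lt) ∷ []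
  ... | no ¬lt rewrite dec-false (row ps (2 + k) <? row ps (1 + k)) ¬lt = []

addableNode-∈ : ∀ ps {z} → Addable ps z → addableNode ps z ∈ allNodes ps
addableNode-∈ ps {z} add =
  ∈-concatMap⁺ (λ k → removableAt ps (suc k) ++ addableAt ps (suc k))
    (lose (∈-upTo⁺ (s≤s (addable≤length ps add))) (∈-++⁺ʳ (removableAt ps (suc z)) (listed z add)))
  where
  listed : ∀ z → Addable ps z → addableNode ps z ∈ addableAt ps (suc z)
  listed zero    _         = here refl
  listed (suc z) (inj₂ lt) rewrite dec-true (row ps (2 + z) <? row ps (1 + z)) lt = here refl

module _ (ℓ i : ℕ) where

  open LadderOrder ℓ

  fhat-just : ∀ {ps n} → firstPlus (reducedRev (signature ℓ i ps)) ≡ just n →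
              fhat ℓ i ps ≡ just (addBox ps (Node.rx n))
  fhat-just e rewrite e = refl

  -- The two order conditions make row `z` the last plus and keep every minus to its right, so the
  -- signature is `Pivoted`.
  fhat-addable : ∀ ps {z} → Addable ps z → nodeResidue ℓ (addableNode ps z) ≡ i →
    (∀ y → y ≢ z → Addable ps y → nodeResidue ℓ (addableNode ps y) ≡ i → addableNode ps y ≺ addableNode ps z) →
    (∀ a → Removable ps a → nodeResidue ℓ (removableNode ps a) ≡ i → addableNode ps z ≺ removableNode ps a) →
    fhat ℓ i ps ≡ just (addBox ps (suc z))
  fhat-addable ps {z} add res others removables = fhat-just first
    where
    open Sorting ℓ (addableNode ps z)
    classified : All (λ m → nodeResidue ℓ m ≡ i → Low m ⊎ High m) (allNodes ps)
    classified = allNodes-All ps (λ a rem e → inj₂ (refl , removables a rem e)) low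
      where
      low : ∀ y → Addable ps y → nodeResidue ℓ (addableNode ps y) ≡ i →
            Low (addableNode ps y) ⊎ High (addableNode ps y)
      low y add e with y ≟ z
      ... | yes refl = inj₁ (inj₁ refl)
      ... | no y≢z   = inj₁ (inj₂ (refl , others y y≢z add e))
    first : firstPlus (reducedRev (signature ℓ i ps)) ≡ just (addableNode ps z)
    first = firstPlus-Pivoted refl []
      (sort-Pivoted (filterRes-All ℓ i classified) (filterRes-∈ ℓ i res (addableNode-∈ ps add)))

-- Removing one box

record Removal (ps : List ℕ) (a : ℕ) : Set where
  field
    rest        : List ℕ
    isPartition : IsPartition rest
    addBox-rest : addBox rest (suc a) ≡ ps
    row-at      : suc (row rest (suc a)) ≡ row ps (suc a)
    row-else    : ∀ b → b ≢ a → row rest (suc b) ≡ row ps (suc b)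
    sum-rest    : suc (sum rest) ≡ sum ps
    length-rest : length rest ≤ length ps

descending-∷ : ∀ {p ps} → row ps 1 ≤ p → Descending ps → Descending (p ∷ ps)
descending-∷ {ps = []}     _  _ = [-]
descending-∷ {ps = _ ∷ _} le d = le ∷ d

remove : ∀ {ps a} → IsPartition ps → Removable ps a → Removal ps a
-- Only here does a part vanish: a removable part 1 is the last part.
remove {suc zero ∷ []} {zero} _ _ = record
  { rest = [] ; isPartition = [] , [] ; addBox-rest = refl ; row-at = refl
  ; row-else = λ { zero b≢a → contradiction refl b≢a ; (suc b) _ → refl }
  ; sum-rest = refl ; length-rest = z≤n }
remove {suc zero ∷ suc _ ∷ _} {zero} _ (s≤s ())
remove {suc zero ∷ zero ∷ _} {zero} (_ ∷ () ∷ _ , _) _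
remove {suc (suc p) ∷ ps} {zero} (_ ∷ pos , d) (s≤s le) = record
  { rest = suc p ∷ ps ; isPartition = s≤s z≤n ∷ pos , descending-∷ le (tail d)
  ; addBox-rest = refl ; row-at = refl
  ; row-else = λ { zero b≢a → contradiction refl b≢a ; (suc b) _ → refl }
  ; sum-rest = refl ; length-rest = ≤-refl }
remove {p ∷ ps} {suc a} (p≥1 ∷ pos , d) rem = record
  { rest = p ∷ rest
  ; isPartition = p≥1 ∷ proj₁ isPartition , descending-∷ (≤-trans (head≤ a refl) (row-head d)) (proj₂ isPartition)
  ; addBox-rest = cong (p ∷_) addBox-rest
  ; row-at = row-at
  ; row-else = λ { zero _ → refl ; (suc b) b≢a → row-else b (b≢a ∘ cong suc) }
  ; sum-rest = trans (sym (+-suc p (sum rest))) (cong (p +_) sum-rest)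
  ; length-rest = s≤s length-rest }
  where
  open Removal (remove {ps} {a} (pos , tail d) rem)
  head≤ : ∀ b → b ≡ a → row rest 1 ≤ row ps 1
  head≤ zero    refl = ≤-trans (n≤1+n _) (≤-reflexive row-at)
  head≤ (suc b) refl = ≤-reflexive (row-else 0 λ ())

last-row>0 : ∀ {p ps} → All (1 ≤_) (p ∷ ps) → 0 < row (p ∷ ps) (suc (length ps))
last-row>0 {ps = []}     (p≥1 ∷ _)  = p≥1
last-row>0 {ps = _ ∷ _} (_ ∷ pos) = last-row>0 pos

last-removable : ∀ {p ps} → All (1 ≤_) (p ∷ ps) → Removable (p ∷ ps) (length ps)
last-removable {p} {ps} pos rewrite row-beyond (p ∷ ps) {suc (length ps)} ≤-refl = last-row>0 pos

-- Descent to the empty partition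

module _ (ℓ : ℕ) where

  open LadderOrder ℓ

  -- By monotonicity distinct indices give nodes in distinct rows, and such nodes are comparable
  -- under `≺`.
  least? : ∀ {P : ℕ → Set} → (∀ a → Dec (P a)) → (f : ℕ → Node) → (∀ {a b} → a < b → Node.rx (f a) < Node.rx (f b)) →
           ∀ m → (∀ a → a < m → ¬ P a) ⊎ (∃[ a ] a < m × P a × (∀ b → b < m → P b → b ≢ a → f a ≺ f b))
  least? P? f mono zero = inj₁ λ _ ()
  least? {P} P? f mono (suc m) with least? P? f mono m | P? m
  ... | inj₁ none | no ¬pm = inj₁ λ a a<sm pa →
    [ (λ a<m → none a a<m pa) , (λ { refl → ¬pm pa }) ]′ (m≤n⇒m<n∨m≡n (≤-pred a<sm))
  ... | inj₁ none | yes pm = inj₂ (m , ≤-refl , pm , λ b b<sm pb b≢m →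
    contradiction pb (none b (≤∧≢⇒< (≤-pred b<sm) b≢m)))
  ... | inj₂ (a , a<m , pa , min) | no ¬pm = inj₂ (a , m<n⇒m<1+n a<m , pa , min′)
    where
    min′ : ∀ b → b < suc m → P b → b ≢ a → f a ≺ f b
    min′ b b<sm pb b≢a with m≤n⇒m<n∨m≡n (≤-pred b<sm)
    ... | inj₁ b<m  = min b b<m pb b≢a
    ... | inj₂ refl = contradiction pb ¬pm
  ... | inj₂ (a , a<m , pa , min) | yes pm with ≺-compare (f a) (f m) (mono a<m)
  ...   | inj₁ a≺m = inj₂ (a , m<n⇒m<1+n a<m , pa , min′)
    where
    min′ : ∀ b → b < suc m → P b → b ≢ a → f a ≺ f b
    min′ b b<sm pb b≢a with m≤n⇒m<n∨m≡n (≤-pred b<sm)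
    ... | inj₁ b<m  = min b b<m pb b≢a
    ... | inj₂ refl = a≺m
  ...   | inj₂ m≺a = inj₂ (m , ≤-refl , pm , min′)
    where
    min′ : ∀ b → b < suc m → P b → b ≢ m → f m ≺ f b
    min′ b b<sm pb b≢m with b ≟ a
    ... | yes refl = m≺a
    ... | no b≢a   = ≺-trans (f m) (f a) (f b) m≺a (min b (≤∧≢⇒< (≤-pred b<sm) b≢m) pb b≢a)

module LadderCrystal (e : ℕ) (1<e : 1 < e) (N : ℕ) (ℓ∣N : suc e ∣ N) where

  private
    ℓ = suc e
    1<ℓ : 1 < ℓ
    1<ℓ = s≤s (<-trans (s≤s z≤n) 1<e)

  open Runners ℓ
  open Words ℓ 1<ℓ
  open Abacus N
  open LadderOrder ℓ
  open JamesMathas e 1<e N ℓ∣N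

  record Shape (ps : List ℕ) : Set where
    constructor shape
    field
      partition : IsPartition ps
      bounded   : length ps < N
    descending : Descending ps
    descending = proj₂ partition

  iRemovable iAddable : ℕ → List ℕ → ℕ → Set
  iRemovable i ps a = Removable ps a × nodeResidue ℓ (removableNode ps a) ≡ i
  iAddable   i ps z = Addable ps z × nodeResidue ℓ (addableNode ps z) ≡ i

  iRemovable? : ∀ i ps a → Dec (iRemovable i ps a)
  iRemovable? i ps a = row ps (2 + a) <? row ps (1 + a) ×-dec nodeResidue ℓ (removableNode ps a) ≟ i

  Separated : ℕ → List ℕ → Set
  Separated i ps = ∀ a z → iRemovable i ps a → iAddable i ps z → addableNode ps z ≺ removableNode ps a

  Least : ℕ → List ℕ → ℕ → Set
  Least i ps a = ∀ b → b < N → iRemovable i ps b → b ≢ a → removableNode ps a ≺ removableNode ps b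

  removable<N : ∀ ps {a} → length ps < N → Removable ps a → a < N
  removable<N ps len<N rem = proj₁ (removable-bead ps len<N rem)

  module RemoveBox {i ps a} (sh : Shape ps) (ira : iRemovable i ps a) where

    open Shape sh
    open Removal (remove partition (proj₁ ira)) public

    rest-shape : Shape rest
    rest-shape = shape isPartition (≤-<-trans length-rest bounded)

    private
      rem = proj₁ ira
      q = proj₁ (proj₂ (removable-bead ps bounded rem))
      a<N = removable<N ps bounded rem

      bead-q : Bead ps (suc q) a
      bead-q = proj₂ (proj₂ (removable-bead ps bounded rem))

      bead-rest : Bead rest q a
      bead-rest = suc-injective (trans bead-q (cong (_+ N) (sym row-at)))

      q-bottom : suc q % ℓ ≡ i
      q-bottom = trans (sym (removable-residue ps {suc q} bead-q)) (proj₂ ira)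

    box-addable : iAddable i rest a
    box-addable = addable a refl , trans (addable-residue rest {q} bead-rest) q-bottom
      where
      addable : ∀ b → b ≡ a → Addable rest b
      addable zero    _    = inj₁ refl
      addable (suc b) refl = inj₂ (begin
        suc (row rest (2 + b))  ≡⟨ row-at ⟩
        row ps (2 + b)          ≤⟨ row-suc descending b ⟩
        row ps (1 + b)          ≡⟨ sym (row-else b λ ()) ⟩
        row rest (1 + b)        ∎)
        where open ≤-Reasoning

    slide : Strip.Slide i (word ps) (word rest)
    slide = record
      { p = q ; at-top = q-bottom
      ; w-gap   = removable⇒gap descending rem bead-q
      ; w-bead  = bead⇒word ps {suc q} a<N bead-q
      ; w′-bead = bead⇒word rest a<N bead-rest
      ; w′-gap  = addable⇒gap (Shape.descending rest-shape) (proj₁ box-addable) bead-rest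
      ; w-else  = λ s s≢q s≢sq → ⇔→≡ (mk⇔ (to s s≢sq) (from s s≢q)) }
      where
      to : ∀ s → s ≢ suc q → word ps s ≡ true → word rest s ≡ true
      to s s≢sq ws with word⇒bead ps ws
      ... | b , b<N , eb = bead⇒word rest b<N (trans eb (cong (_+ N) (sym (row-else b
              λ { refl → s≢sq (+-cancelʳ-≡ (suc b) s (suc q) (trans eb (sym bead-q))) }))))
      from : ∀ s → s ≢ q → word rest s ≡ true → word ps s ≡ true
      from s s≢q ws with word⇒bead rest ws
      ... | b , b<N , eb = bead⇒word ps b<N (trans eb (cong (_+ N) (row-else b
              λ { refl → s≢q (+-cancelʳ-≡ (suc b) s q (trans eb (sym bead-rest))) })))

    strip-rest : JM (strip i (word ps)) → JM (strip i (word rest))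
    strip-rest = JM-cong (Strip.strip-slide i slide)

    -- Only the box to the left of the removed one and the box above it can become removable. Their
    -- residues are `i - 1` and `i + 1` modulo `ℓ`, hence not `i`.
    removable-rest : ∀ b → iRemovable i rest b → b ≢ a × iRemovable i ps b
    removable-rest b (rem-b , res-b) with b ≟ a
    ... | yes refl = ⊥-elim (≁suc 1<ℓ (trans (trans (sym (removable-residue rest {q} bead-rest)) res-b) (sym q-bottom)))
    ... | no b≢a = b≢a , removable (suc b ≟ a) , trans (cong (residue ℓ (suc b)) (sym (row-else b b≢a))) res-b
      where
      removable : Dec (suc b ≡ a) → Removable ps b
      removable (no sb≢a) = subst₂ _<_ (row-else (suc b) sb≢a) (row-else b b≢a) rem-b
      removable (yes refl) = ≤∧≢⇒< (row-suc descending b) λ eq →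
        ≁suc 1<ℓ {suc q} (trans q-bottom (trans (sym res-b)
          (removable-residue rest {suc (suc q)}
            (trans (cong suc (sym (+-suc q (suc b))))
            (trans bead-q (cong (_+ N) (trans eq (sym (row-else b b≢a)))))))))

    -- Shortening row `a` can only block the row after it, so no addable box arises outside row `a`.
    addable-rest : ∀ z → z ≢ a → iAddable i rest z → iAddable i ps z
    addable-rest z z≢a (add-z , res-z) =
      addable z z≢a add-z , trans (cong (λ r → residue ℓ (suc z) (suc r)) (sym (row-else z z≢a))) res-z
      where
      addable : ∀ z → z ≢ a → Addable rest z → Addable ps z
      addable zero    _    _           = inj₁ refl
      addable (suc y) z≢a (inj₂ lt) with y ≟ a
      ... | no y≢a   = inj₂ (subst₂ _<_ (row-else (suc y) z≢a) (row-else y y≢a) lt)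
      ... | yes refl = inj₂ (subst₂ _<_ (row-else (suc y) z≢a) row-at (m<n⇒m<1+n lt))

    addable-node-rest : ∀ {z} → z ≢ a → addableNode rest z ≡ addableNode ps z
    addable-node-rest {z} z≢a = cong (λ r → node (suc z) (suc r) plus) (row-else z z≢a)

    removable-node-rest : ∀ {b} → b ≢ a → removableNode rest b ≡ removableNode ps b
    removable-node-rest {b} b≢a = cong (λ r → node (suc b) r minus) (row-else b b≢a)

    below-new : ∀ m → m ≺ removableNode ps a → m ≺ addableNode rest a
    below-new m = subst (λ r → m ≺ node (suc a) r plus) (sym row-at)

    above-new : ∀ m → removableNode ps a ≺ m → addableNode rest a ≺ m
    above-new m = subst (λ r → node (suc a) r plus ≺ m) (sym row-at)

    new≺removable : Least i ps a → ∀ b → iRemovable i rest b → addableNode rest a ≺ removableNode rest b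
    new≺removable min b irb with removable-rest b irb
    ... | b≢a , irb′ = subst (addableNode rest a ≺_) (sym (removable-node-rest b≢a))
      (above-new (removableNode ps b) (min b (removable<N ps {b} bounded (proj₁ irb′)) irb′ b≢a))

    separated-rest : Least i ps a → Separated i ps → Separated i rest
    separated-rest min sep b z irb iaz with z ≟ a
    ... | yes refl = new≺removable min b irb
    ... | no z≢a with removable-rest b irb
    ... | b≢a , irb′ = subst₂ _≺_ (sym (addable-node-rest z≢a)) (sym (removable-node-rest b≢a))
                              (sep b z irb′ (addable-rest z z≢a iaz))

    -- The removed box is the last plus: the other addable `i`-boxes precede it by `Separated`, and
    -- the remaining removable ones follow it by `Least`.
    fhat-rest : Least i ps a → Separated i ps → fhat ℓ i rest ≡ just ps
    fhat-rest min sep = trans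
      (fhat-addable ℓ i rest (proj₁ box-addable) (proj₂ box-addable)
        (λ y y≢a add res → subst (_≺ addableNode rest a) (sym (addable-node-rest y≢a))
          (below-new (addableNode ps y) (sep a y ira (addable-rest y y≢a (add , res)))))
        (λ b rem res → new≺removable min b (rem , res)))
      (cong just addBox-rest)

  strip-none : ∀ {i ps} → Shape ps → (∀ a → a < N → ¬ iRemovable i ps a) → ∀ s → strip i (word ps) s ≡ word ps s
  strip-none {i} {ps} sh none = Strip.strip-fixed i word-0 no-slide
    where
    open Shape sh
    -- Row `N - 1`, counted from 0, is empty, so its bead is at position 0.
    word-0 : word ps 0 ≡ true
    word-0 = bead⇒word ps {0} (subst (N ∸ 1 <_) 1+[N∸1] ≤-refl)
      (trans 1+[N∸1] (cong (_+ N) (sym (row-beyond ps (≤-pred (subst (length ps <_) (sym 1+[N∸1]) bounded))))))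
      where
      1+[N∸1] : suc (N ∸ 1) ≡ N
      1+[N∸1] = m+[n∸m]≡n (≤-<-trans z≤n bounded)
    no-slide : ∀ p → suc p % ℓ ≡ i → word ps p ≡ false → word ps (suc p) ≡ true → ⊥
    no-slide p bot g w with word⇒bead ps {suc p} w
    ... | a , a<N , ea = none a a<N (gap⇒removable descending bounded a<N ea g ,
                                     trans (removable-residue ps {suc p} ea) bot)

  JM⇒InLadd : ∀ n {ps} → sum ps ≤ n → Shape ps → JM (word ps) → InLadd ℓ ps
  -- While `i`-boxes are being removed, the JM condition is carried for the stripped word instead of
  -- the current one. Once no removable `i`-box is left the two words agree, and a new residue is
  -- chosen. The size bound `n` drops in `removeLeast`.
  Separated⇒InLadd : ∀ n {i ps} → i < ℓ → sum ps ≤ n → Shape ps → Separated i ps →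
                     JM (strip i (word ps)) → InLadd ℓ ps
  removeLeast : ∀ n {i ps a} → i < ℓ → sum ps ≤ n → Shape ps → Separated i ps →
                JM (strip i (word ps)) → iRemovable i ps a → Least i ps a → InLadd ℓ ps

  JM⇒InLadd n {[]} _ _ _ = empty
  JM⇒InLadd n {ps@(p ∷ ps′)} size sh jm =
    [ (λ none → contradiction (rem , refl) (none (length ps′) a<N))
    , (λ (a , _ , ira , min) → removeLeast n i<ℓ size sh separated (Strip.strip-JM i jm) ira min) ]′
    (least? ℓ (iRemovable? i ps) (removableNode ps) s≤s N)
    where
    open Shape sh
    rem : Removable ps (length ps′)
    rem = last-removable (proj₁ partition)
    a<N = removable<N ps bounded rem
    -- The last row always ends in a removable box; taking its residue guarantees that at least one
    -- box comes off in this round.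
    i = nodeResidue ℓ (removableNode ps (length ps′))
    i<ℓ : i < ℓ
    i<ℓ with bead-exists ps a<N
    ... | s , eb = subst (_< ℓ) (sym (removable-residue ps {s} eb)) (m%n<n s ℓ)
    separated : Separated i ps
    separated a z (r , er) (ad , ez) = addable≺removable descending bounded jm r ad (trans er (sym ez))

  Separated⇒InLadd n {i} {ps} i<ℓ size sh sep jm with least? ℓ (iRemovable? i ps) (removableNode ps) s≤s N
  ... | inj₁ none                = JM⇒InLadd n size sh (JM-cong (strip-none sh none) jm)
  ... | inj₂ (a , _ , ira , min) = removeLeast n i<ℓ size sh sep jm ira min

  removeLeast zero i<ℓ size sh sep jm ira min =
    contradiction (subst (_≤ 0) (sym sum-rest) size) λ ()
    where open RemoveBox sh ira
  removeLeast (suc n) {i} i<ℓ size sh sep jm ira min =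
    apply i i<ℓ
      (Separated⇒InLadd n i<ℓ (≤-pred (subst (_≤ suc n) (sym sum-rest) size)) rest-shape (separated-rest min sep) (strip-rest jm))
      (fhat-rest min sep)
    where open RemoveBox sh ira

theorem4p8 : (ℓ : ℕ) → 2 < ℓ → (λ′ : List ℕ) → IsPartition λ′ → IsJM ℓ λ′ → InLadd ℓ λ′
theorem4p8 (suc e) (s≤s 1<e) λ′ part jm =
  JM⇒InLadd (sum λ′) ≤-refl (shape part bounded) (IsJM⇒JM (proj₂ part) bounded jm)
  where
  -- A multiple of `ℓ`, so that positions modulo `ℓ` give residues, and larger than the number of
  -- rows, so that position 0 is a bead.
  N = suc e * suc (length λ′)
  bounded : length λ′ < N
  bounded = m≤n*m (suc (length λ′)) (suc e)
  open JamesMathas e 1<e N (m∣m*n (suc (length λ′)))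
  open LadderCrystal e 1<e N (m∣m*n (suc (length λ′)))
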